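{- Let $m$ be an element of the monoid $M$. Then $m$ is the skeleton of some finite $(3+1)$-free poset if and only if (i) every representative $w\in\Sigma^*$ of $m$ starts with the letter $c_1$ or $t_{12}$, and (ii) no representative $w\in\Sigma^*$ of $m$ contains a factor (consecutive pair of letters) of the form $c_ic_i$ for some $i\ge1$.
   Context: A poset $P$ is $(3+1)$-free if there are no $a,b,c,d\in P$ with $a<b<c$ and $d$ incomparable to each of $a,b,c$. For $a\in P$ let $D_a=\{x\in P:x<a\}$, $U_a=\{x\in P:x>a\}$. Write $a\mathrel{\top}b$ if neither of $D_a,D_b$ contains the other, $a\mathrel{\bot}b$ if neither of $U_a,U_b$ contains the other, and $a\approx b$ if $D_a=D_b$ and $U_a=U_b$. A top of a tangle is a subset $A\subseteq P$ with $|A|\ge2$ that is a connected component of the graph on $P$ with edges $\{a,b\}$ for $a\mathrel{\top}b$; a bottom of a tangle is defined likewise using $\bot$. A top $A$ and bottom $B$ are matched if there are distinct $a_1,a_2\in A$, $b_1,b_2\in B$ with $b_1<a_1$, $b_2<a_2$ and the pairs $\{a_1,a_2\},\{b_1,b_2\},\{b_1,a_2\},\{b_2,a_1\}$ incomparable; in a $(3+1)$-free poset this is a perfect matching. A tangle is a matched pair $(A,B)$, identified with $A\cup B$; a clone set is an equivalence class of $\approx$ on the vertices in no tangle; clone sets and tangles are the parts of $P$. Levels: $L_1$ = minimal elements of $P$, $L_{k+1}$ = minimal elements of $P\setminus(L_1\cup\dots\cup L_k)$, $\ell(a)=k$ if $a\in L_k$; each clone set lies in one level, each tangle in $L_i\cup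 L_{i+1}$ for some $i$. A compatible listing is an ordering $(X_1,\dots,X_m)$ of all parts such that for $a\in X_i$, $b\in X_j$, $i\ne j$: $a<b$ iff $\ell(a)\le\ell(b)-2$, or $\ell(a)=\ell(b)-1$ and $i<j$ (compatible listings exist). Let $\Sigma=\{c_1,c_2,\dots\}\cup\{t_{12},t_{23},\dots,t_{i\,i+1},\dots\}$, $\Sigma^*$ the free monoid on $\Sigma$, and $M$ the quotient of $\Sigma^*$ by the commutation relations $c_ic_j=c_jc_i$ if $|i-j|\ge2$; $c_it_{j\,j+1}=t_{j\,j+1}c_i$ if $i\le j-2$ or $i\ge j+3$; $t_{i\,i+1}t_{j\,j+1}=t_{j\,j+1}t_{i\,i+1}$ if $|i-j|\ge3$. A representative of $m\in M$ is a word in $\Sigma^*$ mapping to $m$. The word of a compatible listing replaces each clone set at level $i$ by $c_i$ and each tangle in levels $\{i,i+1\}$ by $t_{i\,i+1}$; all compatible listings of $P$ give words with the same image in $M$, the skeleton of $P$. -}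

module Defs where

open import Algebra.Bundles using (Monoid)
open import Data.Fin.Base as Fin using (Fin)
open import Data.Fin.Subset using (Subset; _∈_; _∪_; ∣_∣)
open import Data.List.Base using (List; []; _∷_; _++_; length; lookup)
open import Data.List.Properties using (++-assoc; ++-identityʳ)
open import Data.List.Membership.Propositional using () renaming (_∈_ to _∈ₗ_)
open import Data.List.Relation.Binary.Pointwise.Base using (Pointwise)
open import Data.List.Relation.Unary.Unique.Propositional using (Unique)
open import Data.Nat.Base as ℕ using (ℕ; zero; suc; _+_; NonZero)
open import Data.Product.Base using (Σ-syntax; ∃-syntax; _×_; _,_)
open import Data.Sum.Base using (_⊎_)
open import Function.Bundles using (_⇔_)
open import Level using (0ℓ)
open import Relation.Binary.Core using (Rel)
open import Relation.Binary.Structures using (IsDecPartialOrder)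
open import Relation.Binary.Construct.Closure.Equivalence as Eq using (EqClosure)
open import Relation.Binary.PropositionalEquality using (_≡_; _≢_; refl; sym; subst₂)
open import Relation.Nullary.Negation using (¬_)
open import Relation.Unary as Pred using (Pred; ∁; _≐_)
import Relation.Binary.Construct.NonStrictToStrict as ToStrict

-- `t i` is the letter t_{i,i+1}.
data Letter : Set where
  c : (i : ℕ) .⦃ _ : NonZero i ⦄ → Letter
  t : (i : ℕ) .⦃ _ : NonZero i ⦄ → Letter

Word : Set
Word = List Letter

-- Each relation xy = yx is listed in one direction only; _≈ᴹ_ below is
-- symmetric.
data Commute : Letter → Letter → Set where
  cc : ∀ {i j} .⦃ _ : NonZero i ⦄ .⦃ _ : NonZero j ⦄ →
       2 ℕ.≤ ℕ.∣ i - j ∣ → Commute (c i) (c j)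
  ct : ∀ {i j} .⦃ _ : NonZero i ⦄ .⦃ _ : NonZero j ⦄ →
       i + 2 ℕ.≤ j ⊎ j + 3 ℕ.≤ i → Commute (c i) (t j)
  tt : ∀ {i j} .⦃ _ : NonZero i ⦄ .⦃ _ : NonZero j ⦄ →
       3 ℕ.≤ ℕ.∣ i - j ∣ → Commute (t i) (t j)

data Swap : Rel Word 0ℓ where
  swap : ∀ u {x y} v → Commute x y → Swap (u ++ x ∷ y ∷ v) (u ++ y ∷ x ∷ v)

infix 4 _≈ᴹ_

_≈ᴹ_ : Rel Word 0ℓ
_≈ᴹ_ = EqClosure Swap

private
  ++-congʳ : ∀ u {v w} → v ≈ᴹ w → u ++ v ≈ᴹ u ++ w
  ++-congʳ u = Eq.gmap (u ++_) λ where
    (swap p {x} {y} q r) →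
      subst₂ Swap (++-assoc u p (x ∷ y ∷ q)) (++-assoc u p (y ∷ x ∷ q))
        (swap (u ++ p) q r)

  ++-congˡ : ∀ w {u v} → u ≈ᴹ v → u ++ w ≈ᴹ v ++ w
  ++-congˡ w = Eq.gmap (_++ w) λ where
    (swap p {x} {y} q r) →
      subst₂ Swap (sym (++-assoc p (x ∷ y ∷ q) w)) (sym (++-assoc p (y ∷ x ∷ q) w))
        (swap p (q ++ w) r)

  ≡⇒≈ : ∀ {u v} → u ≡ v → u ≈ᴹ v
  ≡⇒≈ refl = Eq.reflexive Swap

-- The quotient of the free monoid is presented as a setoid: an element of M
-- is given by a word, and its representatives are the words equivalent to it.
M : Monoid 0ℓ 0ℓ
M = record
  { Carrier  = Word
  ; _≈_      = _≈ᴹ_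
  ; _∙_      = _++_
  ; ε        = []
  ; isMonoid = record
    { isSemigroup = record
      { isMagma = record
        { isEquivalence = Eq.isEquivalence Swap
        ; ∙-cong        = λ {x} {y} {u} {v} p q →
            Eq.transitive Swap (++-congˡ u p) (++-congʳ y q)
        }
      ; assoc = λ u v w → ≡⇒≈ (++-assoc u v w)
      }
    ; identity = (λ _ → ≡⇒≈ refl) , (λ w → ≡⇒≈ (++-identityʳ w))
    }
  }

_Represents_ : Word → Monoid.Carrier M → Set
w Represents m = Monoid._≈_ M w m

-- A condition on the first letter only, so it holds of the empty word: the
-- empty poset is a (3+1)-free poset and its skeleton is the identity of M.
StartsWith-c₁-or-t₁₂ : Word → Set
StartsWith-c₁-or-t₁₂ w = ∀ x v → w ≡ x ∷ v → x ≡ c 1 ⊎ x ≡ t 1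

data HasFactor-cᵢcᵢ (w : Word) : Set where
  factor : ∀ u i .⦃ _ : NonZero i ⦄ v → w ≡ u ++ c i ∷ c i ∷ v → HasFactor-cᵢcᵢ w

record FinitePoset : Set₁ where
  infix 4 _≤_
  field
    size              : ℕ
    _≤_               : Rel (Fin size) 0ℓ
    isDecPartialOrder : IsDecPartialOrder _≡_ _≤_

  Vertex : Set
  Vertex = Fin size

  open ToStrict {A = Vertex} _≡_ _≤_ public using (_<_)

  infix 4 _∥_ _┬_ _┴_ _≈_

  _∥_ : Rel Vertex 0ℓ
  a ∥ b = ¬ (a ≤ b) × ¬ (b ≤ a)

  D U : Vertex → Pred Vertex 0ℓ
  D a x = x < a
  U a x = a < x

  _┬_ _┴_ _≈_ : Rel Vertex 0ℓ
  a ┬ b = ¬ (D a Pred.⊆ D b) × ¬ (D b Pred.⊆ D a)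
  a ┴ b = ¬ (U a Pred.⊆ U b) × ¬ (U b Pred.⊆ U a)
  a ≈ b = D a ≐ D b × U a ≐ U b

  IsComponent : Rel Vertex 0ℓ → Pred (Subset size) 0ℓ
  IsComponent _—_ A = ∃[ a ] ∀ x → x ∈ A ⇔ EqClosure _—_ a x

  IsTop IsBottom : Pred (Subset size) 0ℓ
  IsTop    A = 2 ℕ.≤ ∣ A ∣ × IsComponent _┬_ A
  IsBottom B = 2 ℕ.≤ ∣ B ∣ × IsComponent _┴_ B

  record Matched (A B : Subset size) : Set where
    field
      a₁ a₂ b₁ b₂ : Vertex
      a₁∈A  : a₁ ∈ A
      a₂∈A  : a₂ ∈ A
      b₁∈B  : b₁ ∈ B
      b₂∈B  : b₂ ∈ B
      a₁≢a₂ : a₁ ≢ a₂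
      b₁≢b₂ : b₁ ≢ b₂
      b₁<a₁ : b₁ < a₁
      b₂<a₂ : b₂ < a₂
      a₁∥a₂ : a₁ ∥ a₂
      b₁∥b₂ : b₁ ∥ b₂
      b₁∥a₂ : b₁ ∥ a₂
      b₂∥a₁ : b₂ ∥ a₁

  IsTangle : Pred (Subset size) 0ℓ
  IsTangle X = ∃[ A ] ∃[ B ] IsTop A × IsBottom B × Matched A B × X ≡ A ∪ B

  InNoTangle : Pred Vertex 0ℓ
  InNoTangle a = ∀ X → IsTangle X → ¬ (a ∈ X)

  IsCloneSet : Pred (Subset size) 0ℓ
  IsCloneSet X = ∃[ a ] InNoTangle a × (∀ x → x ∈ X ⇔ (InNoTangle x × a ≈ x))

  IsPart : Pred (Subset size) 0ℓ
  IsPart X = IsCloneSet X ⊎ IsTangle X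

  Minimal : Pred Vertex 0ℓ → Pred Vertex 0ℓ
  Minimal S a = S a × (∀ b → S b → ¬ (b < a))

  -- L k is the k-th level and L≤ k = L 1 ∪ … ∪ L k; ℓ(a) = k is written L k a.
  L L≤ : ℕ → Pred Vertex 0ℓ
  L zero     = Pred.∅
  L (suc k)  = Minimal (∁ (L≤ k))
  L≤ zero    = Pred.∅
  L≤ (suc k) = L≤ k Pred.∪ L (suc k)

  record CompatibleListing : Set where
    field
      parts      : List (Subset size)
      unique     : Unique parts
      exhaustive : ∀ X → X ∈ₗ parts ⇔ IsPart X
      compatible : ∀ (i j : Fin (length parts)) → i ≢ j →
                   ∀ {a b p q} → a ∈ lookup parts i → b ∈ lookup parts j →
                   L p a → L q b →
                   a < b ⇔ (p + 2 ℕ.≤ q ⊎ (p + 1 ≡ q × i Fin.< j))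

  data HasLetter (X : Subset size) : Letter → Set where
    clone-set : ∀ {i} .⦃ _ : NonZero i ⦄ → IsCloneSet X →
                (∀ {a} → a ∈ X → L i a) → HasLetter X (c i)
    tangle    : ∀ {i} .⦃ _ : NonZero i ⦄ → IsTangle X →
                (∀ {a} → a ∈ X → L i a ⊎ L (suc i) a) → HasLetter X (t i)

  IsWordOf : CompatibleListing → Word → Set
  IsWordOf listing w = Pointwise HasLetter (CompatibleListing.parts listing) w

ThreePlusOneFree : FinitePoset → Set
ThreePlusOneFree P = ∀ a b c d → ¬ (a < b × b < c × d ∥ a × d ∥ b × d ∥ c)
  where open FinitePoset P

-- All compatible listings of a (3+1)-free poset have words with the same image
-- in M, so it does not matter which listing is used.
_IsSkeletonOf_ : Monoid.Carrier M → FinitePoset → Set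
m IsSkeletonOf P = Σ[ X ∈ CompatibleListing ] ∃[ w ] IsWordOf X w × w Represents m
  where open FinitePoset P

{-# OPTIONS --safe #-}

-- If P has a compatible listing with word w, swapping two adjacent parts whose
-- letters commute gives another compatible listing, so every representative w′
-- of the skeleton is the word of a listing.  The first part of a listing cannot
-- lie above level 1, since a vertex below its lowest vertices would lie in a
-- later part; and two adjacent clone sets at the same level would have the same
-- vertices below and above them, hence be equal.
--
-- Conversely, a word w is realized by a poset with four vertices per letter:
-- four clones at level i for c i, and two disjoint edges between the levels i
-- and i + 1 for t i; vertices of different letters are compared as in a
-- compatible listing.  In this poset a ┬ b or a ┴ b only inside one letter t i,
-- so the tangles are the t-blocks.  By (i), the first letter reaching a level k
-- contains k (else it would commute to the front), so the levels are the
-- intended ones.  By (ii), two blocks c i with the same vertices below and above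
-- cannot exist: nothing between them would prevent making them adjacent.
module Submission where

open import Defs
open import Algebra.Bundles using (Monoid)
open import Data.Bool.Base using (true)
open import Data.Empty using (⊥; ⊥-elim)
open import Data.Fin.Base as Fin using (Fin; zero; suc; toℕ; combine; remQuot)
open import Data.Fin.Induction using (po-wellFounded)
open import Data.Fin.Patterns using (0F; 1F)
import Data.Fin.Properties as Fin
open import Data.Fin.Subset using (Subset; _∈_; _∪_; ∣_∣; _-_; ⁅_⁆)
import Data.Fin.Subset.Properties as Subset
open import Data.List.Base as List using (List; []; _∷_; _++_; length; lookup)
open import Data.List.Membership.Propositional using () renaming (_∈_ to _∈ₗ_)
open import Data.List.Membership.Propositional.Properties using (∈-tabulate⁺; ∈-tabulate⁻)
open import Data.List.Properties using (tabulate-lookup)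
open import Data.List.Relation.Binary.Permutation.Propositional using (_↭_; prep; swap; ↭-refl)
open import Data.List.Relation.Binary.Permutation.Propositional.Properties using (All-resp-↭; ∈-resp-↭)
open import Data.List.Relation.Binary.Pointwise as Pointwise using (Pointwise; _∷_)
open import Data.List.Relation.Unary.All as All using (_∷_)
open import Data.List.Relation.Unary.AllPairs as AllPairs using (AllPairs; _∷_)
import Data.List.Relation.Unary.AllPairs.Properties as AllPairs
open import Data.List.Relation.Unary.Any using (here; there)
import Data.List.Relation.Unary.Unique.Propositional.Properties as Unique
open import Data.Nat.Base as ℕ using (ℕ; zero; suc; _+_; _*_; _⊔_; _≤_; _<_; z≤n; s≤s; NonZero)
open import Data.Nat.Properties
open import Data.Product.Base using (∃-syntax; _×_; _,_; proj₁; proj₂)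
open import Data.Sum.Base as Sum using (_⊎_; inj₁; inj₂; [_,_]′)
open import Data.Vec.Base using (tabulate)
open import Data.Vec.Properties using (lookup∘tabulate; []=⇒lookup; lookup⇒[]=)
open import Function.Base using (_∘_; id)
open import Function.Bundles using (_⇔_; mk⇔; Equivalence)
open import Induction.WellFounded using (Acc; acc)
open import Level using (Level; 0ℓ)
open import Relation.Binary.Construct.Closure.Equivalence as Eq using (EqClosure)
open import Relation.Binary.Construct.Closure.ReflexiveTransitive using (ε; _◅_; _◅◅_)
open import Relation.Binary.Construct.Closure.Symmetric using (SymClosure; fwd; bwd)
import Relation.Binary.Construct.StrictToNonStrict as ToNonStrict
open import Relation.Binary.Core using (Rel)
open import Relation.Binary.Definitions using (tri<; tri≈; tri>)
open import Relation.Binary.PropositionalEquality using (_≡_; _≢_; refl; sym; trans; cong; cong₂; subst; subst₂; isEquivalence; resp₂; module ≡-Reasoning)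
open import Relation.Binary.Structures using (IsDecPartialOrder)
open import Relation.Nullary.Decidable using (Dec; yes; no; does; dec-true; decidable-stable; ¬¬-excluded-middle; _×-dec_; _⊎-dec_)
open import Relation.Nullary.Negation using (¬_; contradiction)
open import Relation.Unary as Pred using (Pred; Decidable)

open Equivalence using (to; from)
open Monoid M using () renaming (∙-cong to ++-cong; refl to ≈ᴹ-refl; sym to ≈ᴹ-sym; trans to ≈ᴹ-trans)

private variable
  ℓ : Level
  n : ℕ

-- Finite types: double negation, subsets, bounds and tabulated lists.

-- Levels and parts of vertices are obtained only up to double negation. By finiteness they can be
-- assumed for all vertices at once while proving `⊥`.
¬¬-∀ : {P : Pred (Fin n) ℓ} → (∀ i → ¬ ¬ P i) → ¬ ¬ (∀ i → P i)
¬¬-∀ {n = zero}  h k = k λ ()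
¬¬-∀ {n = suc n} h k = h zero λ p → ¬¬-∀ (h ∘ suc) λ ps → k λ where
  zero    → p
  (suc i) → ps i

module _ {P : Pred (Fin n) ℓ} (P? : Decidable P) where

  comprehension : Subset n
  comprehension = tabulate (does ∘ P?)

  ∈-comprehension⁺ : ∀ {x} → P x → x ∈ comprehension
  ∈-comprehension⁺ {x} p =
    lookup⇒[]= x _ (trans (lookup∘tabulate _ x) (dec-true (P? x) p))

  ∈-comprehension⁻ : ∀ {x} → x ∈ comprehension → P x
  ∈-comprehension⁻ {x} x∈ =
    holds (P? x) (trans (sym (lookup∘tabulate _ x)) ([]=⇒lookup x∈))
    where
    holds : ∀ {A : Set ℓ} (a? : Dec A) → does a? ≡ true → A
    holds (yes a) _ = a

bounded : (f : Fin n → ℕ) → ∃[ K ] ∀ i → f i ≤ K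
bounded {zero}  f = 0 , λ ()
bounded {suc n} f with bounded (f ∘ suc)
... | K , f≤K = f zero ⊔ K , λ where
  zero    → m≤m⊔n _ K
  (suc i) → ≤-trans (f≤K i) (m≤n⊔m (f zero) K)

distinct⇒2≤∣∣ : ∀ {n} {A : Subset n} {x y} → x ∈ A → y ∈ A → x ≢ y → 2 ≤ ∣ A ∣
distinct⇒2≤∣∣ {A = A} {x} {y} x∈A y∈A x≢y = begin
  2               ≡⟨ cong suc (Subset.∣⁅x⁆∣≡1 y) ⟨
  suc ∣ ⁅ y ⁆ ∣   ≤⟨ s≤s (Subset.p⊆q⇒∣p∣≤∣q∣ ⁅y⁆⊆) ⟩
  suc ∣ A - x ∣   ≤⟨ Subset.x∈p⇒∣p-x∣<∣p∣ x∈A ⟩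
  ∣ A ∣           ∎
  where
  open ≤-Reasoning
  ⁅y⁆⊆ : ∀ {z} → z ∈ ⁅ y ⁆ → z ∈ A - x
  ⁅y⁆⊆ z∈ with refl ← Subset.x∈⁅y⁆⇒x≡y y z∈ = Subset.x∈p∧x≢y⇒x∈p-y y∈A (x≢y ∘ sym)

-- The types `Fin (length (tabulate f))` and `Fin n` differ, so indices are compared through `toℕ`.
lookup-tabulate-toℕ : ∀ {A : Set} {n} (f : Fin n → A) i →
  ∃[ k ] toℕ k ≡ toℕ i × lookup (List.tabulate f) i ≡ f k
lookup-tabulate-toℕ {n = suc n} f zero = zero , refl , refl
lookup-tabulate-toℕ {n = suc n} f (suc i) with lookup-tabulate-toℕ (f ∘ suc) i
... | k , k≡i , eq = suc k , cong suc k≡i , eq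

-- Words

lo hi : Letter → ℕ
lo (c i) = i
lo (t i) = i
hi (c i) = i
hi (t i) = suc i

HasLevel : ℕ → Letter → Set
HasLevel k x = lo x ≤ k × k ≤ hi x

0<lo : ∀ x → 0 < lo x
0<lo (c i) = ℕ.>-nonZero⁻¹ i
0<lo (t i) = ℕ.>-nonZero⁻¹ i

hi≤1+lo : ∀ x → hi x ≤ suc (lo x)
hi≤1+lo (c i) = n≤1+n i
hi≤1+lo (t i) = ≤-refl

∣-∣-gap⁻ : ∀ {k} m n → k ≤ ℕ.∣ m - n ∣ → m + k ≤ n ⊎ n + k ≤ m
∣-∣-gap⁻ {k} m n k≤ = Sum.map (λ m≤n → ordered m≤n k≤)
  (λ n≤m → ordered n≤m (subst (k ≤_) (∣-∣-comm m n) k≤)) (≤-total m n)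
  where
  ordered : ∀ {m n} → m ≤ n → k ≤ ℕ.∣ m - n ∣ → m + k ≤ n
  ordered {m} {n} m≤n k≤ = subst (m + k ≤_) (m+[n∸m]≡n m≤n)
    (+-monoʳ-≤ m (subst (k ≤_) (m≤n⇒∣m-n∣≡n∸m m≤n) k≤))

∣-∣-gap⁺ : ∀ {k} m n → m + k ≤ n → k ≤ ℕ.∣ m - n ∣
∣-∣-gap⁺ {k} m n m+k≤n = subst (k ≤_) (sym (m≤n⇒∣m-n∣≡n∸m (m+n≤o⇒m≤o m m+k≤n)))
  (subst (_≤ n ℕ.∸ m) (m+n∸m≡n m k) (∸-monoˡ-≤ m m+k≤n))

-- A uniform form of the three commutation relations: between the levels of the two letters there is
-- at least one free level.
Apart : Letter → Letter → Set
Apart x y = hi x + 2 ≤ lo y ⊎ hi y + 2 ≤ lo x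

commute⇒apart : ∀ {x y} → Commute x y → Apart x y
commute⇒apart (cc {i} {j} d) = ∣-∣-gap⁻ i j d
commute⇒apart (ct {i} {j} d) = Sum.map id (subst (_≤ i) (+-suc j 2)) d
commute⇒apart (tt {i} {j} d) =
  Sum.map (subst (_≤ j) (+-suc i 2)) (subst (_≤ i) (+-suc j 2)) (∣-∣-gap⁻ i j d)

∷-cong : ∀ x {u v} → u ≈ᴹ v → x ∷ u ≈ᴹ x ∷ v
∷-cong x = ++-cong {x = x ∷ []} ≈ᴹ-refl

commute⇒≈ : ∀ {x y} v → Commute x y → x ∷ y ∷ v ≈ᴹ y ∷ x ∷ v
commute⇒≈ v xy = fwd (swap [] v xy) ◅ ε

gap⇒≈ : ∀ x y v → hi x + 2 ≤ lo y → x ∷ y ∷ v ≈ᴹ y ∷ x ∷ v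
gap⇒≈ (c i) (c j) v d = commute⇒≈ v (cc (∣-∣-gap⁺ i j d))
gap⇒≈ (c i) (t j) v d = commute⇒≈ v (ct (inj₁ d))
gap⇒≈ (t i) (c j) v d = ≈ᴹ-sym (commute⇒≈ v (ct (inj₂ (subst (_≤ j) (sym (+-suc i 2)) d))))
gap⇒≈ (t i) (t j) v d = commute⇒≈ v (tt (∣-∣-gap⁺ i j (subst (_≤ j) (sym (+-suc i 2)) d)))

-- For `k` = 1 this is condition (i). That bound is not inherited by tails, whereas the bound at `k`
-- survives the removal of a letter wholly below `k`.
StartsAtMost : ℕ → Word → Set
StartsAtMost k w = ∀ x v → w ≈ᴹ x ∷ v → lo x ≤ k

-- A letter above `k` at the front of the tail would be apart from `y`, so it could also be moved in
-- front of `y`.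
StartsAtMost-tail : ∀ {k y v} → hi y < k → StartsAtMost k (y ∷ v) → StartsAtMost k v
StartsAtMost-tail {k} {y} {v} hy<k h x v′ v≈ = ≮⇒≥ λ k<lx →
  <⇒≱ k<lx (h x (y ∷ v′) (≈ᴹ-trans (∷-cong y v≈)
    (gap⇒≈ y x v′ (subst (_≤ lo x) (+-comm 2 (hi y)) (≤-trans (s≤s hy<k) k<lx)))))

-- Dropping the leading letters wholly below `k` makes the first letter that reaches `k` the head of
-- a word still starting at most at `k`; so this letter contains `k`.
level-earlier : ∀ {k} w → StartsAtMost k w → (p : Fin (length w)) → k ≤ hi (lookup w p) →
                ∃[ q ] q Fin.≤ p × HasLevel k (lookup w q)
level-earlier {k} (y ∷ v) h p k≤ with k ≤? hi y
... | yes k≤hy = zero , z≤n , h y v ≈ᴹ-refl , k≤hy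
level-earlier (y ∷ v) h zero    k≤ | no k≰hy = contradiction k≤ k≰hy
level-earlier (y ∷ v) h (suc p) k≤ | no k≰hy
  with level-earlier v (StartsAtMost-tail {y = y} (≰⇒> k≰hy) h) p k≤
... | q , q≤p , level = suc q , s≤s q≤p , level

FactorFree : Word → Set
FactorFree w = ∀ w′ → w′ ≈ᴹ w → ¬ HasFactor-cᵢcᵢ w′

FactorFree-tail : ∀ {x w} → FactorFree (x ∷ w) → FactorFree w
FactorFree-tail {x} free w′ w′≈w (factor u i v refl) =
  free (x ∷ w′) (∷-cong x w′≈w) (factor (x ∷ u) i v refl)

-- Placed between two blocks `c i`, such a letter has vertices comparable with one block and not
-- with the other.
NeighbourOf : ℕ → Letter → Set
NeighbourOf i x = ∃[ k ] HasLevel k x × (suc k ≡ i ⊎ k ≡ suc i)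

-- A letter not apart from `c i` has a level among `i` - 1, `i`, `i` + 1. As `t j` covers two
-- consecutive levels, only `c i` itself then avoids `i` ± 1.
c-commutes : ∀ i .⦃ _ : NonZero i ⦄ x v → ¬ NeighbourOf i x → x ≢ c i →
             c i ∷ x ∷ v ≈ᴹ x ∷ c i ∷ v
c-commutes i x v ¬nb x≢ with suc (hi x) <? i | suc i <? lo x
... | yes p | _ = ≈ᴹ-sym (gap⇒≈ x (c i) v (subst (_≤ i) (+-comm 2 (hi x)) p))
... | no _ | yes p = gap⇒≈ (c i) x v (subst (_≤ lo x) (+-comm 2 i) p)
c-commutes i (c j) v ¬nb x≢ | no p | no q with <-cmp i j
... | tri< i<j _ _ = contradiction (j , (≤-refl , ≤-refl) , inj₂ (≤-antisym (≮⇒≥ q) i<j)) ¬nb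
... | tri≈ _ refl _ = contradiction refl x≢
... | tri> _ _ j<i = contradiction (j , (≤-refl , ≤-refl) , inj₁ (≤-antisym j<i (≮⇒≥ p))) ¬nb
c-commutes i (t j) v ¬nb x≢ | no p | no q with <-cmp i j
... | tri< i<j _ _ = contradiction (j , (≤-refl , n≤1+n j) , inj₂ (≤-antisym (≮⇒≥ q) i<j)) ¬nb
... | tri≈ _ refl _ = contradiction (suc j , (n≤1+n j , ≤-refl) , inj₂ refl) ¬nb
... | tri> _ _ j<i with m≤n⇒m<n∨m≡n j<i
...   | inj₁ 2+j≤i = contradiction (suc j , (n≤1+n j , ≤-refl) , inj₁ (≤-antisym 2+j≤i (≮⇒≥ p))) ¬nb
...   | inj₂ 1+j≡i = contradiction (j , (≤-refl , n≤1+n j) , inj₁ 1+j≡i) ¬nb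

_≟c_ : ∀ x i .⦃ _ : NonZero i ⦄ → Dec (x ≡ c i)
t j ≟c i = no λ ()
c j ≟c i with j ≟ i
... | yes refl = yes refl
... | no j≢i   = no λ { refl → j≢i refl }

-- The first c i can be moved right past every letter that is not c i and has no
-- level i ± 1, so it would eventually meet another c i.
neighbour-after : ∀ {i} .⦃ _ : NonZero i ⦄ v → FactorFree (c i ∷ v) → (q : Fin (length v)) →
  lookup v q ≡ c i → ¬ (∀ r → r Fin.< q → ¬ NeighbourOf i (lookup v r))
neighbour-after {i} (x ∷ v) free zero refl _ = free _ ≈ᴹ-refl (factor [] i v refl)
neighbour-after {i} (x ∷ v) free (suc q) vq≡ none with x ≟c i
... | yes refl = free _ ≈ᴹ-refl (factor [] i v refl)
... | no x≢ = neighbour-after v (FactorFree-tail swapped) q vq≡ λ r r<q → none (suc r) (s≤s r<q)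
  where
  swapped : FactorFree (x ∷ c i ∷ v)
  swapped w′ w′≈ =
    free w′ (≈ᴹ-trans w′≈ (≈ᴹ-sym (c-commutes i x v (none zero (s≤s z≤n)) x≢)))

neighbour-between : ∀ {i} .⦃ _ : NonZero i ⦄ w → FactorFree w →
  (p q : Fin (length w)) → p Fin.< q → lookup w p ≡ c i → lookup w q ≡ c i →
  ¬ (∀ r → p Fin.< r → r Fin.< q → ¬ NeighbourOf i (lookup w r))
neighbour-between (x ∷ w) free zero (suc q) _ refl wq≡ none =
  neighbour-after w free q wq≡ λ r r<q → none (suc r) (s≤s z≤n) (s≤s r<q)
neighbour-between (x ∷ w) free (suc p) (suc q) (s≤s p<q) wp≡ wq≡ none =
  neighbour-between w (FactorFree-tail free) p q p<q wp≡ wq≡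
    λ r p<r r<q → none (suc r) (s≤s p<r) (s≤s r<q)

-- Skeletons satisfy (i) and (ii)

module Skeletons (P : FinitePoset) where
  open FinitePoset P renaming (_<_ to _≺_; _≤_ to _≼_; _≈_ to _≅_)

  -- Levels of a finite poset.

  L⊆L≤ : ∀ k l {a} → k ≤ l → L k a → L≤ l a
  L⊆L≤ zero    _       _   ()
  L⊆L≤ (suc k) (suc l) k≤l a∈ with m≤n⇒m<n∨m≡n k≤l
  ... | inj₁ (s≤s k<l) = inj₁ (L⊆L≤ (suc k) l k<l a∈)
  ... | inj₂ refl      = inj₂ a∈

  L≤⇒L : ∀ l {a} → L≤ l a → ∃[ k ] k ≤ l × L k a
  L≤⇒L (suc l) (inj₁ a∈) with L≤⇒L l a∈
  ... | k , k≤l , a∈k = k , m≤n⇒m≤1+n k≤l , a∈k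
  L≤⇒L (suc l) (inj₂ a∈) = suc l , ≤-refl , a∈

  L≤-mono : ∀ k l {a} → k ≤ l → L≤ k a → L≤ l a
  L≤-mono k l k≤l a∈ with L≤⇒L k a∈
  ... | j , j≤k , a∈j = L⊆L≤ j l (≤-trans j≤k k≤l) a∈j

  L-≤ : ∀ k l {a} → L k a → L l a → l ≤ k
  L-≤ k (suc l) a∈k a∈l = ≮⇒≥ λ { (s≤s k≤l) → proj₁ a∈l (L⊆L≤ k l k≤l a∈k) }

  L-unique : ∀ k l {a} → L k a → L l a → k ≡ l
  L-unique k l a∈k a∈l = ≤-antisym (L-≤ l k a∈l a∈k) (L-≤ k l a∈k a∈l)

  -- Otherwise `a` is still present when the level of `b` is removed, and `b` is not minimal there.
  L-mono-< : ∀ k l {a b} → L k a → L l b → a ≺ b → k < l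
  L-mono-< (suc k) (suc l) a∈ b∈ a≺b = ≰⇒> λ { (s≤s l≤k) →
    proj₂ b∈ _ (λ a∈l → proj₁ a∈ (L≤-mono l k l≤k a∈l)) a≺b }

  -- Without such a `b`, the vertex `a` would already be minimal one level earlier.
  L-below : ∀ k {a} → L (suc (suc k)) a → ¬ ¬ (∃[ b ] L (suc k) b × b ≺ a)
  L-below k (a∉ , min) none =
    a∉ (inj₂ (a∉ ∘ inj₁ , λ b b∉ b≺a →
      min b [ b∉ , (λ b∈ → none (b , b∈ , b≺a)) ]′ b≺a))

  level : ∀ a → ¬ ¬ (∃[ k ] L k a)
  level a = go a (po-wellFounded (IsDecPartialOrder.isPartialOrder isDecPartialOrder) a)
    where
    go : ∀ a → Acc _≺_ a → ¬ ¬ (∃[ k ] L k a)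
    go a (acc rs) ¬l =
      ¬¬-∀ {P = λ b → ∃[ k ] (b ≺ a → L k b)} below λ levels →
      let K , ≤K = bounded (proj₁ ∘ levels)
          b∈K = λ b b≺a → L⊆L≤ _ K (≤K b) (proj₂ (levels b) b≺a)
          a∉K = λ a∈K → let k , _ , a∈k = L≤⇒L K a∈K in ¬l (k , a∈k)
      -- Everything below `a` lies in the first `K` levels and `a` does not, so `a` is minimal in
      -- what remains.
      in ¬l (suc K , a∉K , λ b b∉ b≺a → b∉ (b∈K b b≺a))
      where
      below : ∀ b → ¬ ¬ (∃[ k ] (b ≺ a → L k b))
      below b ¬k = ¬¬-excluded-middle {A = b ≺ a} λ where
        (yes b≺a) → go b (rs b≺a) λ { (k , b∈k) → ¬k (k , λ _ → b∈k) }
        -- 0 is a default value; the implication is vacuous here.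
        (no b⊀a)  → ¬k (0 , λ b≺a → contradiction b≺a b⊀a)

  -- Clones, parts, and listings as pairwise ordered lists.

  ≅-refl : ∀ {a} → a ≅ a
  ≅-refl = (id , id) , (id , id)

  ≅-sym : ∀ {a b} → a ≅ b → b ≅ a
  ≅-sym ((d , d′) , (u , u′)) = (d′ , d) , (u′ , u)

  ≅-trans : ∀ {a b c} → a ≅ b → b ≅ c → a ≅ c
  ≅-trans ((d , d′) , (u , u′)) ((e , e′) , (v , v′)) =
    (e ∘ d , d′ ∘ e′) , (v ∘ u , u′ ∘ v′)

  -- A vertex in no tangle lies in its own clone set, which becomes a `Subset` once membership is
  -- decided at each of the finitely many vertices.
  part : ∀ a → ¬ ¬ (∃[ X ] IsPart X × a ∈ X)
  part a ¬p = ¬¬-∀ {P = λ x → Dec (InNoTangle x × a ≅ x)} (λ _ → ¬¬-excluded-middle) λ clone? →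
    let a-free = λ X X-tangle a∈X → ¬p (X , inj₂ X-tangle , a∈X)
    in ¬p ( comprehension clone?
          , inj₁ (a , a-free , λ x → mk⇔ (∈-comprehension⁻ clone?) (∈-comprehension⁺ clone?))
          , ∈-comprehension⁺ clone? (a-free , ≅-refl) )

  -- The compatibility condition for parts X listed before Y, in both directions.
  Before : Subset size → Subset size → Set
  Before X Y = ∀ p q {a b} → a ∈ X → b ∈ Y → L p a → L q b →
               (a ≺ b ⇔ p + 1 ≤ q) × (b ≺ a ⇔ q + 2 ≤ p)

  Ordered : Subset size → Subset size → Set
  Ordered X Y = X ≢ Y × Before X Y

  HasLetter⇒HasLevel : ∀ {X x a} p → HasLetter X x → a ∈ X → L p a → HasLevel p x
  HasLetter⇒HasLevel p (clone-set {i} _ X⊆) a∈X a∈p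
    with refl ← L-unique p i a∈p (X⊆ a∈X) = ≤-refl , ≤-refl
  HasLetter⇒HasLevel p (tangle {i} _ X⊆) a∈X a∈p with X⊆ a∈X
  ... | inj₁ a∈i with refl ← L-unique p i a∈p a∈i = ≤-refl , n≤1+n i
  ... | inj₂ a∈i with refl ← L-unique p (suc i) a∈p a∈i = n≤1+n i , ≤-refl

  -- The list order matters only at consecutive levels. For apart letters these do not occur, and
  -- the conditions `p + 1 ≤ q` and `p + 2 ≤ q` coincide.
  Before-swap : ∀ {X Y x y} → HasLetter X x → HasLetter Y y →
                Apart x y → Before X Y → Before Y X
  Before-swap hX hY xy X<Y q p {b} {a} b∈Y a∈X b∈q a∈p
    with X<Y p q a∈X b∈Y a∈p b∈q
       | HasLetter⇒HasLevel p hX a∈X a∈p | HasLetter⇒HasLevel q hY b∈Y b∈q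
  ... | a≺b , b≺a | lx≤p , p≤hx | ly≤q , q≤hy =
      mk⇔ (weaken q ∘ to b≺a) (from b≺a ∘ strengthen q p (Sum.swap pq))
    , mk⇔ (strengthen p q pq ∘ to a≺b) (from a≺b ∘ weaken p)
    where
    pq : p + 2 ≤ q ⊎ q + 2 ≤ p
    pq = Sum.map (λ h → ≤-trans (+-monoˡ-≤ 2 p≤hx) (≤-trans h ly≤q))
                 (λ h → ≤-trans (+-monoˡ-≤ 2 q≤hy) (≤-trans h lx≤p)) xy
    weaken : ∀ k {l} → k + 2 ≤ l → k + 1 ≤ l
    weaken k = ≤-trans (+-monoʳ-≤ k (s≤s z≤n))
    strengthen : ∀ k l → k + 2 ≤ l ⊎ l + 2 ≤ k → k + 1 ≤ l → k + 2 ≤ l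
    strengthen k l (inj₁ k+2≤l) _     = k+2≤l
    strengthen k l (inj₂ l+2≤k) k+1≤l =
      contradiction (m+n≤o⇒m≤o l l+2≤k) (<⇒≱ (subst (_≤ l) (+-comm k 1) k+1≤l))

  -- A listing with pairwise order in place of indices, so that exchanging two adjacent parts alters
  -- a single pair.
  record Arrangement (w : Word) : Set where
    field
      parts      : List (Subset size)
      letters    : Pointwise HasLetter parts w
      ordered    : AllPairs Ordered parts
      exhaustive : ∀ {X} → IsPart X → X ∈ₗ parts

  swap-parts : ∀ u {x y v Xs} → Apart x y →
               Pointwise HasLetter Xs (u ++ x ∷ y ∷ v) → AllPairs Ordered Xs →
               ∃[ Ys ] Xs ↭ Ys × Pointwise HasLetter Ys (u ++ y ∷ x ∷ v) × AllPairs Ordered Ys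
  swap-parts [] xy (_∷_ {x = X} hX (_∷_ {x = Y} {xs = Zs} hY hZs))
                   (((X≢Y , X<Y) ∷ X<Zs) ∷ Y<Zs ∷ oZs) =
    Y ∷ X ∷ Zs , swap X Y ↭-refl , hY ∷ hX ∷ hZs ,
    ((X≢Y ∘ sym , Before-swap hX hY xy X<Y) ∷ Y<Zs) ∷ X<Zs ∷ oZs
  swap-parts (z ∷ u) xy (_∷_ {x = Z} hZ hXs) (Z<Xs ∷ oXs) with swap-parts u xy hXs oXs
  ... | Ys , Xs↭Ys , hYs , oYs =
    Z ∷ Ys , prep Z Xs↭Ys , hZ ∷ hYs , All-resp-↭ Xs↭Ys Z<Xs ∷ oYs

  arrangement-swap : ∀ u {x y} v → Apart x y →
                     Arrangement (u ++ x ∷ y ∷ v) → Arrangement (u ++ y ∷ x ∷ v)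
  arrangement-swap u v xy A with swap-parts u xy (Arrangement.letters A) (Arrangement.ordered A)
  ... | Ys , Xs↭Ys , hYs , oYs = record
    { parts      = Ys
    ; letters    = hYs
    ; ordered    = oYs
    ; exhaustive = ∈-resp-↭ Xs↭Ys ∘ Arrangement.exhaustive A
    }

  arrangement-≈ : ∀ {u v} → u ≈ᴹ v → Arrangement u → Arrangement v
  arrangement-≈ ε A = A
  arrangement-≈ (fwd (swap u v xy) ◅ u≈v) A = arrangement-≈ u≈v
    (arrangement-swap u v (commute⇒apart xy) A)
  arrangement-≈ (bwd (swap u v xy) ◅ u≈v) A = arrangement-≈ u≈v
    (arrangement-swap u v (Sum.swap (commute⇒apart xy)) A)

  listing⇒arrangement : (X : CompatibleListing) → ∀ {w} → IsWordOf X w → Arrangement w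
  listing⇒arrangement X hX = record
    { parts      = parts
    ; letters    = hX
    ; ordered    = AllPairs.zip (unique , subst (AllPairs Before) (tabulate-lookup parts)
                     (AllPairs.tabulate⁺-< λ {i} {j} → before i j))
    ; exhaustive = λ {X} → from (exhaustive X)
    }
    where
    open CompatibleListing X
    before : ∀ i j → i Fin.< j → Before (lookup parts i) (lookup parts j)
    before i j i<j p q {a} {b} a∈ b∈ a∈p b∈q =
        -- As `i<j`, the two alternatives of compatibility merge into `p + 1 ≤ q`; in the reverse
        -- direction only the gap of two survives.
        mk⇔ ([ ≤-trans (+-monoʳ-≤ p (s≤s z≤n)) , ≤-reflexive ∘ proj₁ ]′ ∘ to ij)
            (from ij ∘ Sum.map (subst (_≤ q) (sym (+-suc p 1))) (_, i<j) ∘ m≤n⇒m<n∨m≡n)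
      , mk⇔ ([ id , (λ (_ , j<i) → contradiction j<i (<-asym i<j)) ]′ ∘ to ji) (from ji ∘ inj₁)
      where
      i≢j : i ≢ j
      i≢j refl = <-irrefl refl i<j
      ij = compatible i j i≢j {p = p} {q} a∈ b∈ a∈p b∈q
      ji = compatible j i (i≢j ∘ sym) {p = q} {p} b∈ a∈ b∈q a∈p

  -- The first letter of a skeleton.

  -- In a tangle, `b₁ < a₁` cannot both lie on the upper level.
  lowest : ∀ {X x} → HasLetter X x → ∃[ a ] a ∈ X × L (lo x) a
  lowest (clone-set (a , free , X≐) X⊆) = a , a∈X , X⊆ a∈X
    where a∈X = from (X≐ a) (free , ≅-refl)
  lowest (tangle {i} (A , B , _ , _ , matched , refl) X⊆) = lowest′ i (X⊆ b₁∈X) (X⊆ a₁∈X)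
    where
    open Matched matched
    b₁∈X = Subset.x∈p∪q⁺ {p = A} (inj₂ b₁∈B)
    a₁∈X = Subset.x∈p∪q⁺ {q = B} (inj₁ a₁∈A)
    lowest′ : ∀ i → L i b₁ ⊎ L (suc i) b₁ → L i a₁ ⊎ L (suc i) a₁ →
              ∃[ a ] a ∈ A ∪ B × L i a
    lowest′ i (inj₁ b₁∈i) _           = b₁ , b₁∈X , b₁∈i
    lowest′ i (inj₂ _)    (inj₁ a₁∈i) = a₁ , a₁∈X , a₁∈i
    lowest′ i (inj₂ b₁∈)  (inj₂ a₁∈)  =
      contradiction (L-mono-< (suc i) (suc i) b₁∈ a₁∈ b₁<a₁) (<-irrefl refl)

  -- If the first part lay above level 1, a lowest vertex `a` of it would have some `b` one level
  -- below it. The part of `b` is not the first one, which has no vertex so low; but from a later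
  -- part `b ≺ a` needs a gap of two levels.
  starts-low : ∀ {x v} → Arrangement (x ∷ v) → lo x ≤ 1
  starts-low {x} {v} A = ≮⇒≥ λ 1<lo → go (lo x) refl 1<lo letters ordered exhaustive
    where
    open Arrangement A
    go : ∀ {Xs} k → lo x ≡ k → 1 < k → Pointwise HasLetter Xs (x ∷ v) →
         AllPairs Ordered Xs → (∀ {Y} → IsPart Y → Y ∈ₗ Xs) → ⊥
    go (suc zero) _ (s≤s ())
    go (suc (suc k)) lo≡ _ (_∷_ {x = X} hX _) (X<Ys ∷ _) exh with lowest hX
    ... | a , a∈X , a∈lo with a∈k ← subst (λ k → L k a) lo≡ a∈lo =
      L-below k a∈k λ (b , b∈k , b≺a) → part b λ (Y , Y-part , b∈Y) →
        nowhere (exh Y-part) b∈Y b∈k b≺a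
      where
      nowhere : ∀ {b Y} → Y ∈ₗ X ∷ _ → b ∈ Y → L (suc k) b → b ≺ a → ⊥
      nowhere (here refl) b∈X b∈k _ =
        1+n≰n (subst (_≤ suc k) lo≡ (proj₁ (HasLetter⇒HasLevel (suc k) hX b∈X b∈k)))
      nowhere (there Y∈) b∈Y b∈k b≺a =
        1+n≰n (subst (_≤ suc (suc k)) (cong suc (+-comm k 2))
          (to (proj₂ (proj₂ (All.lookup X<Ys Y∈) (suc (suc k)) (suc k) a∈X b∈Y a∈k b∈k)) b≺a))

  -- Adjacent clone sets in a skeleton.

  NotBetween : Subset size → Subset size → Subset size → Set
  NotBetween X Y Z = Z ≡ X ⊎ Z ≡ Y ⊎ (Before Z X × Before Z Y) ⊎ (Before X Z × Before Y Z)

  adjacent : ∀ u {x y v Xs} → Pointwise HasLetter Xs (u ++ x ∷ y ∷ v) → AllPairs Ordered Xs →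
    ∃[ X ] ∃[ Y ] X ∈ₗ Xs × Y ∈ₗ Xs × HasLetter X x × HasLetter Y y × X ≢ Y ×
      (∀ {Z} → Z ∈ₗ Xs → NotBetween X Y Z)
  adjacent [] (_∷_ {x = X} hX (_∷_ {x = Y} hY _)) (((X≢Y , _) ∷ X<Zs) ∷ Y<Zs ∷ _) =
    X , Y , here refl , there (here refl) , hX , hY , X≢Y , λ where
      (here Z≡X)         → inj₁ Z≡X
      (there (here Z≡Y)) → inj₂ (inj₁ Z≡Y)
      (there (there Z∈)) → inj₂ (inj₂ (inj₂ (proj₂ (All.lookup X<Zs Z∈) , proj₂ (All.lookup Y<Zs Z∈))))
  adjacent (_ ∷ u) (_ ∷ hXs) (W<Xs ∷ oXs) with adjacent u hXs oXs
  ... | X , Y , X∈ , Y∈ , hX , hY , X≢Y , sep = X , Y , there X∈ , there Y∈ , hX , hY , X≢Y , λ where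
      (here refl) → inj₂ (inj₂ (inj₁ (proj₂ (All.lookup W<Xs X∈) , proj₂ (All.lookup W<Xs Y∈))))
      (there Z∈)  → sep Z∈

  clone-sets-≡ : ∀ {X Y a b} → IsCloneSet X → IsCloneSet Y → a ∈ X → b ∈ Y → a ≅ b → X ≡ Y
  clone-sets-≡ X-clones Y-clones a∈X b∈Y a≅b =
    Subset.⊆-antisym (⊆ X-clones Y-clones a∈X b∈Y a≅b) (⊆ Y-clones X-clones b∈Y a∈X (≅-sym a≅b))
    where
    ⊆ : ∀ {X Y a b} → IsCloneSet X → IsCloneSet Y → a ∈ X → b ∈ Y → a ≅ b → ∀ {x} → x ∈ X → x ∈ Y
    ⊆ (a₀ , _ , X≐) (b₀ , _ , Y≐) a∈X b∈Y a≅b {x} x∈X with to (X≐ x) x∈X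
    ... | x-free , a₀≅x = from (Y≐ x) (x-free ,
      ≅-trans (proj₂ (to (Y≐ _) b∈Y)) (≅-trans (≅-sym a≅b)
        (≅-trans (≅-sym (proj₂ (to (X≐ _) a∈X))) a₀≅x)))

  -- Take `a` and `b` in the two adjacent clone sets. Any other part is before both or after both,
  -- so its vertices compare with `a` as with `b`; vertices of the two sets share their level and
  -- are comparable with neither. Hence `a ≅ b`, and the two sets coincide.
  no-factor : ∀ {w} → Arrangement w → ¬ HasFactor-cᵢcᵢ w
  no-factor A (factor u i v refl) with adjacent u (Arrangement.letters A) (Arrangement.ordered A)
  ... | X , Y , X∈ , Y∈ , hX@(clone-set X-clones X⊆) , hY@(clone-set Y-clones Y⊆) , X≢Y , sep
    with lowest hX | lowest hY
  ... | a , a∈X , a∈i | b , b∈Y , b∈i =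
    ¬¬-∀ level λ ℓ → ¬¬-∀ part λ in-part →
      X≢Y (clone-sets-≡ X-clones Y-clones a∈X b∈Y (a≅b ℓ in-part))
    where
    a≅b : (∀ z → ∃[ k ] L k z) → (∀ z → ∃[ Z ] IsPart Z × z ∈ Z) → a ≅ b
    a≅b ℓ in-part = ((λ {z} → proj₁ (D≐ z)) , λ {z} → proj₂ (D≐ z))
                  , ((λ {z} → proj₁ (U≐ z)) , λ {z} → proj₂ (U≐ z))
      where
      same-level : ∀ {x y} {B : Set} → L i x → L i y → x ≺ y → B
      same-level x∈i y∈i x≺y = contradiction (L-mono-< i i x∈i y∈i x≺y) (<-irrefl refl)
      D≐ : ∀ z → (z ≺ a → z ≺ b) × (z ≺ b → z ≺ a)
      U≐ : ∀ z → (a ≺ z → b ≺ z) × (b ≺ z → a ≺ z)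
      D≐ z with ℓ z | in-part z
      ... | k , z∈k | Z , Z-part , z∈Z with sep (Arrangement.exhaustive A Z-part)
      ... | inj₁ refl = same-level (X⊆ z∈Z) a∈i , same-level (X⊆ z∈Z) b∈i
      ... | inj₂ (inj₁ refl) = same-level (Y⊆ z∈Z) a∈i , same-level (Y⊆ z∈Z) b∈i
      ... | inj₂ (inj₂ (inj₁ (Z<X , Z<Y))) = from zb ∘ to za , from za ∘ to zb
        where za = proj₁ (Z<X k i z∈Z a∈X z∈k a∈i)
              zb = proj₁ (Z<Y k i z∈Z b∈Y z∈k b∈i)
      ... | inj₂ (inj₂ (inj₂ (X<Z , Y<Z))) = from zb ∘ to za , from za ∘ to zb
        where za = proj₂ (X<Z i k a∈X z∈Z a∈i z∈k)
              zb = proj₂ (Y<Z i k b∈Y z∈Z b∈i z∈k)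
      U≐ z with ℓ z | in-part z
      ... | k , z∈k | Z , Z-part , z∈Z with sep (Arrangement.exhaustive A Z-part)
      ... | inj₁ refl = same-level a∈i (X⊆ z∈Z) , same-level b∈i (X⊆ z∈Z)
      ... | inj₂ (inj₁ refl) = same-level a∈i (Y⊆ z∈Z) , same-level b∈i (Y⊆ z∈Z)
      ... | inj₂ (inj₂ (inj₁ (Z<X , Z<Y))) = from zb ∘ to za , from za ∘ to zb
        where za = proj₂ (Z<X k i z∈Z a∈X z∈k a∈i)
              zb = proj₂ (Z<Y k i z∈Z b∈Y z∈k b∈i)
      ... | inj₂ (inj₂ (inj₂ (X<Z , Y<Z))) = from zb ∘ to za , from za ∘ to zb
        where za = proj₁ (X<Z i k a∈X z∈Z a∈i z∈k)
              zb = proj₁ (Y<Z i k b∈Y z∈Z b∈i z∈k)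

-- The poset of a word satisfying (i) and (ii)

height : Letter → Fin 2 → ℕ
height (c i) _  = i
height (t i) 0F = i
height (t i) 1F = suc i

lo≤height : ∀ x h → lo x ≤ height x h
lo≤height (c i) h  = ≤-refl
lo≤height (t i) 0F = ≤-refl
lo≤height (t i) 1F = n≤1+n i

height≤hi : ∀ x h → height x h ≤ hi x
height≤hi (c i) h  = ≤-refl
height≤hi (t i) 0F = n≤1+n i
height≤hi (t i) 1F = ≤-refl

height-0F : ∀ x → height x 0F ≡ lo x
height-0F (c i) = refl
height-0F (t i) = refl

height-1F : ∀ x → height x 1F ≡ hi x
height-1F (c i) = refl
height-1F (t i) = refl

height-surjective : ∀ {k} x → HasLevel k x → ∃[ h ] height x h ≡ k
height-surjective x (lo≤k , k≤hi) with m≤n⇒m<n∨m≡n lo≤k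
... | inj₁ lo<k = 1F , trans (height-1F x) (≤-antisym (≤-trans (hi≤1+lo x) lo<k) k≤hi)
... | inj₂ lo≡k = 0F , trans (height-0F x) lo≡k

module Realization (w : Word) where

  -- The vertices and their order.

  V : Set
  V = Fin (length w * 4)

  -- A vertex is a position in w, a height and a strand; the edges inside a letter
  -- t i join equal strands, and a letter c i ignores both coordinates.
  pos : V → Fin (length w)
  pos a = proj₁ (remQuot {length w} 4 a)

  cell : V → Fin 2 × Fin 2
  cell a = remQuot {2} 2 (proj₂ (remQuot {length w} 4 a))

  up strand : V → Fin 2
  up     = proj₁ ∘ cell
  strand = proj₂ ∘ cell

  vertex : Fin (length w) → Fin 2 → Fin 2 → V
  vertex p h s = combine p (combine h s)

  pos-vertex : ∀ p h s → pos (vertex p h s) ≡ p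
  pos-vertex p h s = cong proj₁ (Fin.remQuot-combine p (combine h s))

  cell-vertex : ∀ p h s → cell (vertex p h s) ≡ (h , s)
  cell-vertex p h s = trans (cong (remQuot {2} 2 ∘ proj₂) (Fin.remQuot-combine p (combine h s)))
    (Fin.remQuot-combine h s)

  up-vertex : ∀ p h s → up (vertex p h s) ≡ h
  up-vertex p h s = cong proj₁ (cell-vertex p h s)

  strand-vertex : ∀ p h s → strand (vertex p h s) ≡ s
  strand-vertex p h s = cong proj₂ (cell-vertex p h s)

  vertex-η : ∀ a → vertex (pos a) (up a) (strand a) ≡ a
  vertex-η a = trans (cong (combine (pos a)) (Fin.combine-remQuot {2} 2 _))
                     (Fin.combine-remQuot {length w} 4 a)

  letter : V → Letter
  letter a = lookup w (pos a)

  lev : V → ℕ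
  lev a = height (letter a) (up a)

  lev-vertex : ∀ p h s → lev (vertex p h s) ≡ height (lookup w p) h
  lev-vertex p h s = cong₂ (λ q → height (lookup w q)) (pos-vertex p h s) (up-vertex p h s)

  lo≤lev : ∀ a → lo (letter a) ≤ lev a
  lo≤lev a = lo≤height (letter a) (up a)

  lev≤hi : ∀ a → lev a ≤ hi (letter a)
  lev≤hi a = height≤hi (letter a) (up a)

  lev-close : ∀ a b → pos a ≡ pos b → lev a ≤ suc (lev b)
  lev-close a b pa≡pb = begin
    lev a              ≤⟨ lev≤hi a ⟩
    hi (letter a)      ≤⟨ hi≤1+lo (letter a) ⟩
    suc (lo (letter a)) ≡⟨ cong (suc ∘ lo ∘ lookup w) pa≡pb ⟩
    suc (lo (letter b)) ≤⟨ s≤s (lo≤lev b) ⟩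
    suc (lev b)        ∎
    where open ≤-Reasoning

  infix 4 _≺_ _≺?_

  Near : Rel V 0ℓ
  Near a b = pos a Fin.< pos b ⊎ (pos a ≡ pos b × strand a ≡ strand b)

  _≺_ : Rel V 0ℓ
  a ≺ b = 2 + lev a ≤ lev b ⊎ (1 + lev a ≡ lev b × Near a b)

  _≺?_ : ∀ a b → Dec (a ≺ b)
  a ≺? b = (2 + lev a ≤? lev b) ⊎-dec ((1 + lev a ≟ lev b) ×-dec
    ((pos a Fin.<? pos b) ⊎-dec ((pos a Fin.≟ pos b) ×-dec (strand a Fin.≟ strand b))))

  near-≤ : ∀ {a b} → Near a b → pos a Fin.≤ pos b
  near-≤ (inj₁ p<q)       = <⇒≤ p<q
  near-≤ (inj₂ (p≡q , _)) = ≤-reflexive (cong toℕ p≡q)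

  ≺⇒lev< : ∀ {a b} → a ≺ b → lev a < lev b
  ≺⇒lev< (inj₁ far)      = ≤-trans (n≤1+n _) far
  ≺⇒lev< (inj₂ (eq , _)) = ≤-reflexive eq

  ≺-near : ∀ {a b} → lev b ≤ suc (lev a) → a ≺ b → Near a b
  ≺-near b≤ (inj₁ far)        = contradiction b≤ (<⇒≱ far)
  ≺-near b≤ (inj₂ (_ , near)) = near

  -- Two strict increases of the level already give a gap of two.
  ≺-trans : ∀ {a b c} → a ≺ b → b ≺ c → a ≺ c
  ≺-trans a≺b b≺c = inj₁ (≤-trans (s≤s (≺⇒lev< a≺b)) (≺⇒lev< b≺c))

  ≺-irrefl : ∀ {a b} → a ≡ b → ¬ a ≺ b
  ≺-irrefl refl a≺a = <-irrefl refl (≺⇒lev< a≺a)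

  poset : FinitePoset
  poset = record
    { size = length w * 4
    ; _≤_  = ToNonStrict._≤_ _≡_ _≺_
    ; isDecPartialOrder = record
      { isPartialOrder = ToNonStrict.isPartialOrder _≡_ _≺_ record
        { isEquivalence = isEquivalence
        ; irrefl        = ≺-irrefl
        ; trans         = ≺-trans
        ; <-resp-≈      = resp₂ _≺_
        }
      ; _≟_  = Fin._≟_
      ; _≤?_ = ToNonStrict.decidable _≡_ _≺_ Fin._≟_ _≺?_
      }
    }

  open FinitePoset poset hiding (_≤_; isDecPartialOrder) renaming (_<_ to _⊏_)

  ⊏⇒≺ : ∀ {a b} → a ⊏ b → a ≺ b
  ⊏⇒≺ (inj₁ a≺b , _)   = a≺b
  ⊏⇒≺ (inj₂ a≡b , a≢b) = contradiction a≡b a≢b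

  ≺⇒⊏ : ∀ {a b} → a ≺ b → a ⊏ b
  ≺⇒⊏ a≺b = inj₁ a≺b , λ a≡b → ≺-irrefl a≡b a≺b

  -- Incomparability with the ends of the chain `a`, `b`, `e` forces `d` to be one level above `a`
  -- and one below `e`, and then `e`, `d`, `a` to have weakly increasing positions. The chain gives
  -- the positions of `a`, `b`, `e` the opposite order, so `a` and `e` share a letter although they
  -- are two levels apart.
  threePlusOneFree : ThreePlusOneFree poset
  threePlusOneFree a b e d (a⊏b , b⊏e , (d≰a , a≰d) , _ , (d≰e , e≰d)) =
    1+n≰n (≤-trans 2+a≤e (lev-close e a (sym pa≡pe)))
    where
    a≺b = ⊏⇒≺ a⊏b
    b≺e = ⊏⇒≺ b⊏e
    2+a≤e : 2 + lev a ≤ lev e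
    2+a≤e = ≤-trans (s≤s (≺⇒lev< a≺b)) (≺⇒lev< b≺e)
    d≤1+a : lev d ≤ suc (lev a)
    d≤1+a = ≮⇒≥ (a≰d ∘ inj₁ ∘ inj₁)
    e≤1+d : lev e ≤ suc (lev d)
    e≤1+d = ≮⇒≥ (d≰e ∘ inj₁ ∘ inj₁)
    1+a≤d : suc (lev a) ≤ lev d
    1+a≤d = ℕ.s≤s⁻¹ (≤-trans 2+a≤e e≤1+d)
    e≤2+a : lev e ≤ 2 + lev a
    e≤2+a = ≤-trans e≤1+d (s≤s d≤1+a)
    pd≤pa : pos d Fin.≤ pos a
    pd≤pa = ≮⇒≥ λ pa<pd → a≰d (inj₁ (inj₂ (≤-antisym 1+a≤d d≤1+a , inj₁ pa<pd)))
    pe≤pd : pos e Fin.≤ pos d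
    pe≤pd = ≮⇒≥ λ pd<pe →
      d≰e (inj₁ (inj₂ (≤-antisym (≤-trans (s≤s d≤1+a) 2+a≤e) e≤1+d , inj₁ pd<pe)))
    pa≤pb : pos a Fin.≤ pos b
    pa≤pb = near-≤ (≺-near (ℕ.s≤s⁻¹ (≤-trans (≺⇒lev< b≺e) e≤2+a)) a≺b)
    pb≤pe : pos b Fin.≤ pos e
    pb≤pe = near-≤ (≺-near (≤-trans e≤2+a (s≤s (≺⇒lev< a≺b))) b≺e)
    pa≡pe : pos a ≡ pos e
    pa≡pe = Fin.toℕ-injective (≤-antisym (≤-trans pa≤pb pb≤pe) (≤-trans pe≤pd pd≤pa))

  -- Comparison of down-sets and up-sets.

  -- The upper and the lower vertices of the letters `t i`; a vertex of a letter `c i` is neither.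
  Top Bottom : Pred V 0ℓ
  Top a    = lo (letter a) < lev a
  Bottom a = lev a < hi (letter a)

  D-lev : ∀ {a b} → lev a < lev b → D a Pred.⊆ D b
  D-lev a<b x⊏a = ≺⇒⊏ (inj₁ (≤-trans (s≤s (≺⇒lev< (⊏⇒≺ x⊏a))) a<b))

  U-lev : ∀ {a b} → lev b < lev a → U a Pred.⊆ U b
  U-lev b<a a⊏x = ≺⇒⊏ (inj₁ (≤-trans (s≤s b<a) (≺⇒lev< (⊏⇒≺ a⊏x))))

  -- Vertices two or more levels down lie below both, so only the level just underneath has to be
  -- examined.
  D-mono : ∀ {a b} → lev a ≡ lev b →
           (∀ x → suc (lev x) ≡ lev a → Near x a → Near x b) → D a Pred.⊆ D b
  D-mono a≡b near x⊏a with ⊏⇒≺ x⊏a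
  ... | inj₁ far      = ≺⇒⊏ (inj₁ (≤-trans far (≤-reflexive a≡b)))
  ... | inj₂ (eq , n) = ≺⇒⊏ (inj₂ (trans eq a≡b , near _ eq n))

  U-mono : ∀ {a b} → lev a ≡ lev b →
           (∀ x → suc (lev a) ≡ lev x → Near a x → Near b x) → U a Pred.⊆ U b
  U-mono a≡b near a⊏x with ⊏⇒≺ a⊏x
  ... | inj₁ far      = ≺⇒⊏ (inj₁ (≤-trans (≤-reflexive (cong (2 +_) (sym a≡b))) far))
  ... | inj₂ (eq , n) = ≺⇒⊏ (inj₂ (trans (cong suc (sym a≡b)) eq , near _ eq n))

  D-pos : ∀ {a b} → lev a ≡ lev b → pos a Fin.< pos b → D a Pred.⊆ D b
  D-pos a≡b pa<pb = D-mono a≡b λ x _ n → inj₁ (≤-<-trans (near-≤ n) pa<pb)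

  U-pos : ∀ {a b} → lev a ≡ lev b → pos b Fin.< pos a → U a Pred.⊆ U b
  U-pos a≡b pb<pa = U-mono a≡b λ x _ n → inj₁ (<-≤-trans pb<pa (near-≤ n))

  -- A vertex just below `a` inside the same letter would make `a` a `Top`; what is below `a` from
  -- earlier letters is also below `b`.
  D-flat : ∀ {a b} → lev a ≡ lev b → pos a ≡ pos b → ¬ Top a → D a Pred.⊆ D b
  D-flat {a} a≡b pa≡pb ¬top = D-mono a≡b λ where
    x _  (inj₁ px<pa)       → inj₁ (subst (pos x Fin.<_) pa≡pb px<pa)
    x eq (inj₂ (px≡pa , _)) → contradiction
      (subst₂ _≤_ (cong (suc ∘ lo ∘ lookup w) px≡pa) eq (s≤s (lo≤lev x))) ¬top

  U-flat : ∀ {a b} → lev a ≡ lev b → pos a ≡ pos b → ¬ Bottom a → U a Pred.⊆ U b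
  U-flat {a} a≡b pa≡pb ¬bot = U-mono a≡b λ where
    x _  (inj₁ pa<px)       → inj₁ (subst (Fin._< pos x) pa≡pb pa<px)
    x eq (inj₂ (pa≡px , _)) → contradiction
      (subst₂ _≤_ (sym eq) (cong (hi ∘ lookup w) (sym pa≡px)) (lev≤hi x)) ¬bot

  Twins : Pred V 0ℓ → Rel V 0ℓ
  Twins Q a b = pos a ≡ pos b × Q a × Q b

  -- Down-sets grow with the level, and on one level with the position. Only vertices of the same
  -- letter and level remain, and `D-flat` leaves just the tops.
  ┬⇒twins : ∀ {a b} → a ┬ b → Twins Top a b
  ┬⇒twins {a} {b} (a⊈b , b⊈a) with <-cmp (lev a) (lev b)
  ... | tri< a<b _ _ = ⊥-elim (a⊈b (D-lev a<b))
  ... | tri> _ _ b<a = ⊥-elim (b⊈a (D-lev b<a))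
  ... | tri≈ _ a≡b _ with Fin.<-cmp (pos a) (pos b)
  ...   | tri< p _ _ = ⊥-elim (a⊈b (D-pos a≡b p))
  ...   | tri> _ _ p = ⊥-elim (b⊈a (D-pos (sym a≡b) p))
  ...   | tri≈ _ pa≡pb _ = pa≡pb
    , decidable-stable (_ <? _) (λ ¬q → a⊈b (D-flat a≡b pa≡pb ¬q))
    , decidable-stable (_ <? _) (λ ¬q → b⊈a (D-flat (sym a≡b) (sym pa≡pb) ¬q))

  ┴⇒twins : ∀ {a b} → a ┴ b → Twins Bottom a b
  ┴⇒twins {a} {b} (a⊈b , b⊈a) with <-cmp (lev a) (lev b)
  ... | tri< a<b _ _ = ⊥-elim (b⊈a (U-lev a<b))
  ... | tri> _ _ b<a = ⊥-elim (a⊈b (U-lev b<a))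
  ... | tri≈ _ a≡b _ with Fin.<-cmp (pos a) (pos b)
  ...   | tri< p _ _ = ⊥-elim (b⊈a (U-pos (sym a≡b) p))
  ...   | tri> _ _ p = ⊥-elim (a⊈b (U-pos a≡b p))
  ...   | tri≈ _ pa≡pb _ = pa≡pb
    , decidable-stable (_ <? _) (λ ¬q → a⊈b (U-flat a≡b pa≡pb ¬q))
    , decidable-stable (_ <? _) (λ ¬q → b⊈a (U-flat (sym a≡b) (sym pa≡pb) ¬q))

  vertex-ext : ∀ {a b} → pos a ≡ pos b → up a ≡ up b → strand a ≡ strand b → a ≡ b
  vertex-ext {a} {b} p u s = begin
    a                                  ≡⟨ vertex-η a ⟨
    vertex (pos a) (up a) (strand a)   ≡⟨ cong₂ (λ f → f) (cong₂ vertex p u) s ⟩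
    vertex (pos b) (up b) (strand b)   ≡⟨ vertex-η b ⟩
    b                                  ∎
    where open ≡-Reasoning

  Top⇒up : ∀ {a} → Top a → up a ≡ 1F
  Top⇒up {a} top with up a
  ... | 0F = contradiction (sym (height-0F (letter a))) (<⇒≢ top)
  ... | 1F = refl

  Bottom⇒up : ∀ {a} → Bottom a → up a ≡ 0F
  Bottom⇒up {a} bot with up a
  ... | 0F = refl
  ... | 1F = contradiction (height-1F (letter a)) (<⇒≢ bot)

  Top⇒lev : ∀ {a} → Top a → lev a ≡ suc (lo (letter a))
  Top⇒lev {a} top = ≤-antisym (≤-trans (lev≤hi a) (hi≤1+lo (letter a))) top

  Bottom⇒lev : ∀ {a} → Bottom a → suc (lev a) ≡ hi (letter a)
  Bottom⇒lev {a} bot = ≤-antisym bot (≤-trans (hi≤1+lo (letter a)) (s≤s (lo≤lev a)))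

  ≺⇒strand≡ : ∀ {a b} → pos a ≡ pos b → a ≺ b → strand a ≡ strand b
  ≺⇒strand≡ {a} {b} pa≡pb a≺b with ≺-near (lev-close b a (sym pa≡pb)) a≺b
  ... | inj₁ pa<pb = contradiction (cong toℕ pa≡pb) (<⇒≢ pa<pb)
  ... | inj₂ (_ , eq) = eq

  strands-∥ : ∀ {a b} → pos a ≡ pos b → strand a ≢ strand b → a ∥ b
  strands-∥ p s = (λ { (inj₁ a≺b) → s (≺⇒strand≡ p a≺b) ; (inj₂ refl) → s refl })
                , (λ { (inj₁ b≺a) → s (sym (≺⇒strand≡ (sym p) b≺a)) ; (inj₂ refl) → s refl })

  under : ∀ {a} → Top a → ∃[ x ] x ≺ a × pos x ≡ pos a × strand x ≡ strand a
  under {a} top = x , inj₂ (1+x≡a , inj₂ (px , sx)) , px , sx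
    where x  = vertex (pos a) 0F (strand a)
          px = pos-vertex (pos a) 0F (strand a)
          sx = strand-vertex (pos a) 0F (strand a)
          1+x≡a : suc (lev x) ≡ lev a
          1+x≡a = trans (cong suc (trans (lev-vertex _ _ _) (height-0F (letter a))))
                        (sym (Top⇒lev top))

  over : ∀ {a} → Bottom a → ∃[ x ] a ≺ x × pos x ≡ pos a × strand x ≡ strand a
  over {a} bot = x , inj₂ (1+a≡x , inj₂ (sym px , sym sx)) , px , sx
    where x  = vertex (pos a) 1F (strand a)
          px = pos-vertex (pos a) 1F (strand a)
          sx = strand-vertex (pos a) 1F (strand a)
          1+a≡x : suc (lev a) ≡ lev x
          1+a≡x = trans (Bottom⇒lev bot) (sym (trans (lev-vertex _ _ _) (height-1F (letter a))))

  -- On different strands, the vertex under each one on its own strand is not below the other.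
  twins⇒┬ : ∀ {a b} → Twins Top a b → a ≡ b ⊎ a ┬ b
  twins⇒┬ {a} {b} (p , ta , tb) with strand a Fin.≟ strand b
  ... | yes s = inj₁ (vertex-ext p (trans (Top⇒up ta) (sym (Top⇒up tb))) s)
  ... | no ¬s = inj₂ (⊈ p ta ¬s , ⊈ (sym p) tb (¬s ∘ sym))
    where
    ⊈ : ∀ {a b} → pos a ≡ pos b → Top a → strand a ≢ strand b → ¬ D a Pred.⊆ D b
    ⊈ p ta ¬s a⊆b with under ta
    ... | x , x≺a , px , sx = ¬s (trans (sym sx) (≺⇒strand≡ (trans px p) (⊏⇒≺ (a⊆b (≺⇒⊏ x≺a)))))

  twins⇒┴ : ∀ {a b} → Twins Bottom a b → a ≡ b ⊎ a ┴ b
  twins⇒┴ {a} {b} (p , ba , bb) with strand a Fin.≟ strand b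
  ... | yes s = inj₁ (vertex-ext p (trans (Bottom⇒up ba) (sym (Bottom⇒up bb))) s)
  ... | no ¬s = inj₂ (⊈ p ba ¬s , ⊈ (sym p) bb (¬s ∘ sym))
    where
    ⊈ : ∀ {a b} → pos a ≡ pos b → Bottom a → strand a ≢ strand b → ¬ U a Pred.⊆ U b
    ⊈ p ba ¬s a⊆b with over ba
    ... | x , a≺x , px , sx =
      ¬s (sym (trans (≺⇒strand≡ (trans (sym p) (sym px)) (⊏⇒≺ (a⊆b (≺⇒⊏ a≺x)))) sx))

  -- The tangles are the blocks of the letters `t i`.

  -- Common to tops and bottoms: the twin relation is symmetric and transitive and agrees with the
  -- edges up to equality, so a component with two distinct vertices consists of all `Q`-vertices of
  -- one letter.
  module Components {_—_ : Rel V 0ℓ} {Q : Pred V 0ℓ} (Q? : Decidable Q)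
    (—⇒twins : ∀ {a b} → a — b → Twins Q a b)
    (twins⇒— : ∀ {a b} → Twins Q a b → a ≡ b ⊎ a — b) where

    side : Fin (length w) → Subset (length w * 4)
    side p = comprehension (λ a → (pos a Fin.≟ p) ×-dec Q? a)

    ∈-side⁺ : ∀ {p x} → pos x ≡ p × Q x → x ∈ side p
    ∈-side⁺ {p} = ∈-comprehension⁺ (λ a → (pos a Fin.≟ p) ×-dec Q? a)

    ∈-side⁻ : ∀ {p x} → x ∈ side p → pos x ≡ p × Q x
    ∈-side⁻ {p} = ∈-comprehension⁻ (λ a → (pos a Fin.≟ p) ×-dec Q? a)

    closure⇒twins : ∀ {a b} → EqClosure _—_ a b → a ≡ b ⊎ Twins Q a b
    closure⇒twins ε = inj₁ refl
    closure⇒twins (a—x ◅ x—*b) with step a—x | closure⇒twins x—*b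
      where
      step : ∀ {a b} → SymClosure _—_ a b → Twins Q a b
      step (fwd r) = —⇒twins r
      step (bwd r) = let p , qa , qb = —⇒twins r in sym p , qb , qa
    ... | tw | inj₁ refl = inj₂ tw
    ... | p , qa , _ | inj₂ (p′ , _ , qb) = inj₂ (trans p p′ , qa , qb)

    twins⇒closure : ∀ {a b} → Twins Q a b → EqClosure _—_ a b
    twins⇒closure tw with twins⇒— tw
    ... | inj₁ refl = ε
    ... | inj₂ r    = fwd r ◅ ε

    closure⇒side : ∀ {a x} → Q a → EqClosure _—_ a x → pos x ≡ pos a × Q x
    closure⇒side qa a—*x with closure⇒twins a—*x
    ... | inj₁ refl         = refl , qa
    ... | inj₂ (p , _ , qx) = sym p , qx

    side-component : ∀ {a} → Q a → IsComponent _—_ (side (pos a))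
    side-component {a} qa = a , λ x → mk⇔
      (λ x∈ → let p , qx = ∈-side⁻ x∈ in twins⇒closure (sym p , qa , qx))
      (∈-side⁺ ∘ closure⇒side qa)

    component-side : ∀ {A a b} → IsComponent _—_ A → a ∈ A → b ∈ A → a ≢ b →
                     Twins Q a b × (∀ x → x ∈ A ⇔ (pos x ≡ pos a × Q x))
    component-side {A} {a} {b} (r , A≐) a∈A b∈A a≢b = tw , λ x → mk⇔
        (closure⇒side qa ∘ within a∈A)
        (λ (p , qx) → from (A≐ x) (to (A≐ a) a∈A ◅◅ twins⇒closure (sym p , qa , qx)))
      where
      within : ∀ {x y} → x ∈ A → y ∈ A → EqClosure _—_ x y
      within x∈A y∈A = Eq.symmetric _—_ (to (A≐ _) x∈A) ◅◅ to (A≐ _) y∈A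
      tw : Twins Q a b
      tw = [ (λ a≡b → contradiction a≡b a≢b) , id ]′ (closure⇒twins (within a∈A b∈A))
      qa = proj₁ (proj₂ tw)

  module Tops = Components (λ a → lo (letter a) <? lev a) ┬⇒twins twins⇒┬
  module Bottoms = Components (λ a → lev a <? hi (letter a)) ┴⇒twins twins⇒┴

  block : Fin (length w) → Subset (length w * 4)
  block p = comprehension (λ a → pos a Fin.≟ p)

  ∈-block⁺ : ∀ {p x} → pos x ≡ p → x ∈ block p
  ∈-block⁺ {p} = ∈-comprehension⁺ (λ a → pos a Fin.≟ p)

  ∈-block⁻ : ∀ {p x} → x ∈ block p → pos x ≡ p
  ∈-block⁻ {p} = ∈-comprehension⁻ (λ a → pos a Fin.≟ p)

  -- The letter is some `t i`, expressed by the fact that `c i` has only one level.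
  Tangled : Fin (length w) → Set
  Tangled p = lo (lookup w p) < hi (lookup w p)

  tangled? : ∀ p → Dec (Tangled p)
  tangled? p = _ <? _

  top-or-bottom : ∀ a → Tangled (pos a) → Top a ⊎ Bottom a
  top-or-bottom a lo<hi with lo (letter a) <? lev a
  ... | yes top = inj₁ top
  ... | no ¬top = inj₂ (≤-<-trans (≮⇒≥ ¬top) lo<hi)

  block-tangle : ∀ p → Tangled p → IsTangle (block p)
  block-tangle p lo<hi = Tops.side p , Bottoms.side p
    , (distinct⇒2≤∣∣ {A = Tops.side p} (∈tops 0F) (∈tops 1F) (≢ 1F 1F)
      , subst (IsComponent _┬_ ∘ Tops.side) (pos-vertex p 1F 0F) (Tops.side-component (top 0F)))
    , (distinct⇒2≤∣∣ {A = Bottoms.side p} (∈bottoms 0F) (∈bottoms 1F) (≢ 0F 0F)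
      , subst (IsComponent _┴_ ∘ Bottoms.side) (pos-vertex p 0F 0F) (Bottoms.side-component (bottom 0F)))
    , record
      -- The two strands are the two disjoint edges of the matching.
      { a₁ = vertex p 1F 0F ; a₂ = vertex p 1F 1F ; b₁ = vertex p 0F 0F ; b₂ = vertex p 0F 1F
      ; a₁∈A = ∈tops 0F ; a₂∈A = ∈tops 1F ; b₁∈B = ∈bottoms 0F ; b₂∈B = ∈bottoms 1F
      ; a₁≢a₂ = ≢ 1F 1F ; b₁≢b₂ = ≢ 0F 0F
      ; b₁<a₁ = ≺⇒⊏ (strand-≺ 0F) ; b₂<a₂ = ≺⇒⊏ (strand-≺ 1F)
      ; a₁∥a₂ = ∥ 1F 1F ; b₁∥b₂ = ∥ 0F 0F ; b₁∥a₂ = ∥ 0F 1F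
      ; b₂∥a₁ = let x , y = ∥ 1F 0F in y , x
      }
    , Subset.⊆-antisym
        (λ {x} x∈ → let px = ∈-block⁻ x∈ in
          Subset.x∈p∪q⁺ (Sum.map (λ tx → Tops.∈-side⁺ (px , tx)) (λ bx → Bottoms.∈-side⁺ (px , bx))
            (top-or-bottom x (subst Tangled (sym px) lo<hi))))
        (λ x∈ → ∈-block⁺ ([ proj₁ ∘ Tops.∈-side⁻ , proj₁ ∘ Bottoms.∈-side⁻ ]′
          (Subset.x∈p∪q⁻ (Tops.side p) (Bottoms.side p) x∈)))
    where
    letter≡ : ∀ h s → letter (vertex p h s) ≡ lookup w p
    letter≡ h s = cong (lookup w) (pos-vertex p h s)
    top : ∀ s → Top (vertex p 1F s)
    top s rewrite lev-vertex p 1F s | letter≡ 1F s | height-1F (lookup w p) = lo<hi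
    bottom : ∀ s → Bottom (vertex p 0F s)
    bottom s rewrite lev-vertex p 0F s | letter≡ 0F s | height-0F (lookup w p) = lo<hi
    ∈tops : ∀ s → vertex p 1F s ∈ Tops.side p
    ∈tops s = Tops.∈-side⁺ (pos-vertex p 1F s , top s)
    ∈bottoms : ∀ s → vertex p 0F s ∈ Bottoms.side p
    ∈bottoms s = Bottoms.∈-side⁺ (pos-vertex p 0F s , bottom s)
    strands≢ : ∀ g h → strand (vertex p g 0F) ≢ strand (vertex p h 1F)
    strands≢ g h eq with () ← trans (sym (strand-vertex p g 0F)) (trans eq (strand-vertex p h 1F))
    ∥ : ∀ g h → vertex p g 0F ∥ vertex p h 1F
    ∥ g h = strands-∥ (trans (pos-vertex p g 0F) (sym (pos-vertex p h 1F))) (strands≢ g h)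
    ≢ : ∀ g h → vertex p g 0F ≢ vertex p h 1F
    ≢ g h = strands≢ g h ∘ cong strand
    strand-≺ : ∀ s → vertex p 0F s ≺ vertex p 1F s
    strand-≺ s = inj₂
      ( trans (Bottom⇒lev (bottom s)) (trans (cong hi (letter≡ 0F s))
          (sym (trans (lev-vertex p 1F s) (height-1F (lookup w p)))))
      , inj₂ (trans (pos-vertex p 0F s) (sym (pos-vertex p 1F s))
             , trans (strand-vertex p 0F s) (sym (strand-vertex p 1F s))))

  -- The top fills the upper side of one letter and the bottom the lower side of one letter. These
  -- letters agree: `a₁` and `a₂` share level and position, so `b₁ < a₁` across different letters
  -- would give `b₁ < a₂`.
  tangle-block : ∀ {X} → IsTangle X → ∃[ p ] Tangled p × X ≡ block p
  tangle-block (A , B , (_ , A-comp) , (_ , B-comp) , m , refl)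
    with Tops.component-side A-comp (Matched.a₁∈A m) (Matched.a₂∈A m) (Matched.a₁≢a₂ m)
       | Bottoms.component-side B-comp (Matched.b₁∈B m) (Matched.b₂∈B m) (Matched.b₁≢b₂ m)
  ... | (pa , ta₁ , ta₂) , A≐ | _ , B≐ = pos a₁ , tangled , Subset.⊆-antisym
      (λ {x} x∈ → ∈-block⁺
        ([ proj₁ ∘ to (A≐ x) , (λ x∈B → trans (proj₁ (to (B≐ x) x∈B)) b₁≡a₁) ]′
          (Subset.x∈p∪q⁻ A B x∈)))
      (λ {x} x∈ → let px = ∈-block⁻ x∈ in
        Subset.x∈p∪q⁺ (Sum.map
          (λ tx → from (A≐ x) (px , tx)) (λ bx → from (B≐ x) (trans px (sym b₁≡a₁) , bx))
          (top-or-bottom x (subst Tangled (sym px) tangled))))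
    where
    open Matched m
    tangled : Tangled (pos a₁)
    tangled = <-≤-trans ta₁ (lev≤hi a₁)
    lev≡ : lev a₁ ≡ lev a₂
    lev≡ = trans (Top⇒lev ta₁) (trans (cong (suc ∘ lo ∘ lookup w) pa) (sym (Top⇒lev ta₂)))
    b₁≡a₁ : pos b₁ ≡ pos a₁
    b₁≡a₁ with ⊏⇒≺ b₁<a₁
    ... | inj₁ far = contradiction (inj₁ (inj₁ (≤-trans far (≤-reflexive lev≡)))) (proj₁ b₁∥a₂)
    ... | inj₂ (eq , inj₁ p<) = contradiction
      (inj₁ (inj₂ (trans eq lev≡ , inj₁ (subst (pos b₁ Fin.<_) pa p<)))) (proj₁ b₁∥a₂)
    ... | inj₂ (_ , inj₂ (p≡ , _)) = p≡

  free⇒untangled : ∀ {a} → InNoTangle a → ¬ Tangled (pos a)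
  free⇒untangled {a} a-free lo<hi = a-free _ (block-tangle (pos a) lo<hi) (∈-block⁺ refl)

  untangled⇒free : ∀ {a} → ¬ Tangled (pos a) → InNoTangle a
  untangled⇒free ¬t X X-tangle a∈X with tangle-block X-tangle
  ... | p , lo<hi , refl = ¬t (subst Tangled (sym (∈-block⁻ a∈X)) lo<hi)

  untangled-lev : ∀ {a} → ¬ Tangled (pos a) → lev a ≡ lo (letter a)
  untangled-lev {a} ¬t = ≤-antisym (≤-trans (lev≤hi a) (≮⇒≥ ¬t)) (lo≤lev a)

  same-block-≈ : ∀ {a b} → ¬ Tangled (pos a) → pos a ≡ pos b → a ≈ b
  same-block-≈ {a} {b} ¬t p =
      (D-flat lev≡ p ¬top-a , D-flat (sym lev≡) (sym p) ¬top-b)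
    , (U-flat lev≡ p ¬bot-a , U-flat (sym lev≡) (sym p) ¬bot-b)
    where
    ¬t′ = subst (¬_ ∘ Tangled) p ¬t
    lev≡ : lev a ≡ lev b
    lev≡ = trans (untangled-lev ¬t) (trans (cong (lo ∘ lookup w) p) (sym (untangled-lev ¬t′)))
    ¬top-a = λ top → ¬t (<-≤-trans top (lev≤hi a))
    ¬top-b = λ top → ¬t′ (<-≤-trans top (lev≤hi b))
    ¬bot-a = λ bot → ¬t (≤-<-trans (lo≤lev a) bot)
    ¬bot-b = λ bot → ¬t′ (≤-<-trans (lo≤lev b) bot)

  vertex-at : ∀ {k} p s → HasLevel k (lookup w p) → ∃[ a ] pos a ≡ p × strand a ≡ s × lev a ≡ k
  vertex-at p s level with height-surjective (lookup w p) level
  ... | h , eq = vertex p h s , pos-vertex p h s , strand-vertex p h s , trans (lev-vertex p h s) eq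

  0<lev : ∀ a → 0 < lev a
  0<lev a = ≤-trans (0<lo (letter a)) (lo≤lev a)

  -- The levels of the poset of a word.

  module Levels (low : StartsAtMost 1 w) where

    below : ∀ a k → 0 < k → lev a ≡ suc k → ∃[ b ] lev b ≡ k × b ≺ a
    below a k 0<k a≡ with level-earlier w (λ x v w≈ → ≤-trans (low x v w≈) 0<k) (pos a)
                           (≤-trans (n≤1+n k) (≤-trans (≤-reflexive (sym a≡)) (lev≤hi a)))
    -- The strand of `a` puts the new vertex below `a` even when `q` is the position of `a` itself.
    ... | q , q≤p , level with vertex-at q (strand a) level
    ... | b , refl , sb , b≡ = b , b≡ , inj₂ (trans (cong suc b≡) (sym a≡) , near (m≤n⇒m<n∨m≡n q≤p))
      where
      near : pos b Fin.< pos a ⊎ toℕ (pos b) ≡ toℕ (pos a) → Near b a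
      near (inj₁ p<) = inj₁ p<
      near (inj₂ p≡) = inj₂ (Fin.toℕ-injective p≡ , sb)

    -- A vertex with `lev` beyond `suc k` is not minimal: `below` supplies one under it whose `lev`
    -- still exceeds `k`.
    L-step : ∀ k → (∀ a → L≤ k a ⇔ lev a ≤ k) → ∀ a → L (suc k) a ⇔ lev a ≡ suc k
    L-step k L≤⇔ a = mk⇔
      (λ (a∉ , min) → ≤-antisym (≮⇒≥ (above (lev a) refl min)) (≰⇒> (a∉ ∘ from (L≤⇔ a))))
      (λ a≡ → (λ a∈ → 1+n≰n (≤-trans (≤-reflexive (sym a≡)) (to (L≤⇔ a) a∈)))
            , λ b b∉ b⊏a → b∉ (from (L≤⇔ b)
                (ℕ.s≤s⁻¹ (≤-trans (≺⇒lev< (⊏⇒≺ b⊏a)) (≤-reflexive a≡)))))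
      where
      above : ∀ l → lev a ≡ l → (∀ b → ¬ L≤ k b → ¬ b ⊏ a) → ¬ suc k < l
      above (suc l) eq min (s≤s k<l) with below a l (≤-trans (s≤s z≤n) k<l) eq
      ... | b , refl , b≺a = min b (λ b∈ → <⇒≱ k<l (to (L≤⇔ b) b∈)) (≺⇒⊏ b≺a)

    L≤⇔lev : ∀ k a → L≤ k a ⇔ lev a ≤ k
    L≤⇔lev zero    a = mk⇔ (λ ()) (λ a≤0 → contradiction a≤0 (<⇒≱ (0<lev a)))
    L≤⇔lev (suc k) a = mk⇔
      [ m≤n⇒m≤1+n ∘ to (L≤⇔lev k a) , ≤-reflexive ∘ to L⇔ ]′
      (λ a≤ → Sum.map (from (L≤⇔lev k a) ∘ ℕ.s≤s⁻¹) (from L⇔) (m≤n⇒m<n∨m≡n a≤))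
      where L⇔ = L-step k (L≤⇔lev k) a

    L⇔lev : ∀ k a → L k a ⇔ lev a ≡ k
    L⇔lev zero    a = mk⇔ (λ ()) (λ a≡0 → contradiction (sym a≡0) (<⇒≢ (0<lev a)))
    L⇔lev (suc k) a = L-step k (L≤⇔lev k) a

    -- By `below`, the down-set of `a` reaches the level just under `a` and so determines `lev a`;
    -- an empty one means level 1.
    ≈⇒lev≡ : ∀ {a b} → a ≈ b → lev a ≡ lev b
    ≈⇒lev≡ ((a⊆b , b⊆a) , _) = ≤-antisym (≤ᴸ _ refl a⊆b) (≤ᴸ _ refl b⊆a)
      where
      ≤ᴸ : ∀ {a b} k → lev a ≡ k → D a Pred.⊆ D b → k ≤ lev b
      ≤ᴸ         zero          _  _   = z≤n
      ≤ᴸ {b = b} (suc zero)    _  _   = 0<lev b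
      ≤ᴸ {a} {b} (suc (suc k)) eq a⊆b with below a (suc k) (s≤s z≤n) eq
      ... | x , x≡ , x≺a = subst (_< lev b) x≡ (≺⇒lev< (⊏⇒≺ (a⊆b (≺⇒⊏ x≺a))))

    -- Clone sets, and the listing of the blocks.

    module Listing (factor-free : FactorFree w) where

      -- A letter in between that meets a level next to that of `a` has a vertex below `b` and not
      -- `a`, or above `a` and not `b`. So there is none, and two equal letters `c i` with nothing
      -- between them contradict `neighbour-between`.
      no-later-clone : ∀ {a b} → ¬ Tangled (pos a) → ¬ Tangled (pos b) → a ≈ b → ¬ pos a Fin.< pos b
      no-later-clone {a} {b} ¬ta ¬tb a≈b@((_ , Db⊆Da) , (Ua⊆Ub , _)) pa<pb =
        go (letter a) (letter b) refl refl
        where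
        none : ∀ r → pos a Fin.< r → r Fin.< pos b → ¬ NeighbourOf (lev a) (lookup w r)
        none r pa<r r<pb (k , level , nb) with vertex-at r 0F level
        none r pa<r r<pb (k , level , inj₁ 1+k≡a) | y , refl , _ , refl =
          <⇒≱ pa<r (near-≤ (≺-near (≤-reflexive (sym 1+k≡a))
            (⊏⇒≺ (Db⊆Da (≺⇒⊏ (inj₂ (trans 1+k≡a (≈⇒lev≡ a≈b) , inj₁ r<pb)))))))
        none r pa<r r<pb (k , level , inj₂ k≡1+a) | y , refl , _ , refl =
          <⇒≱ r<pb (near-≤ (≺-near (≤-reflexive (trans k≡1+a (cong suc (≈⇒lev≡ a≈b))))
            (⊏⇒≺ (Ua⊆Ub (≺⇒⊏ (inj₂ (sym k≡1+a , inj₁ pa<r)))))))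
        go : ∀ x y → letter a ≡ x → letter b ≡ y → ⊥
        go (t i) _     ea _  = ¬ta (subst (λ x → lo x < hi x) (sym ea) ≤-refl)
        go (c i) (t j) _  eb = ¬tb (subst (λ x → lo x < hi x) (sym eb) ≤-refl)
        go (c i) (c j) ea eb =
          neighbour-between {i} w factor-free (pos a) (pos b) pa<pb ea (trans eb (c-cong j≡i))
            λ r pa<r r<pb → none r pa<r r<pb ∘ subst (λ k → NeighbourOf k (lookup w r)) (sym a≡i)
          where
          a≡i : lev a ≡ i
          a≡i = trans (untangled-lev ¬ta) (cong lo ea)
          j≡i : j ≡ i
          j≡i = trans (sym (trans (untangled-lev ¬tb) (cong lo eb))) (trans (sym (≈⇒lev≡ a≈b)) a≡i)
          c-cong : ∀ {i j} .⦃ _ : NonZero i ⦄ .⦃ _ : NonZero j ⦄ → i ≡ j → c i ≡ c j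
          c-cong refl = refl

      clone-class : ∀ {a} → InNoTangle a → ∀ x → (InNoTangle x × a ≈ x) ⇔ pos x ≡ pos a
      clone-class {a} a-free x = mk⇔ same-pos
        (λ p → untangled⇒free (¬t ∘ subst Tangled p) , same-block-≈ ¬t (sym p))
        where
        ¬t = free⇒untangled a-free
        same-pos : InNoTangle x × a ≈ x → pos x ≡ pos a
        same-pos (x-free , a≈x@((d , d′) , (u , u′))) with Fin.<-cmp (pos x) (pos a)
        ... | tri< p _ _ = contradiction p
          (no-later-clone (free⇒untangled x-free) ¬t ((d′ , d) , (u′ , u)))
        ... | tri≈ _ p _ = p
        ... | tri> _ _ p = contradiction p (no-later-clone ¬t (free⇒untangled x-free) a≈x)

      block-clones : ∀ p → ¬ Tangled p → IsCloneSet (block p)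
      block-clones p ¬t = a , a-free , λ x → mk⇔
          (λ x∈ → from (clone-class a-free x) (trans (∈-block⁻ x∈) (sym pa)))
          (λ cl → ∈-block⁺ (trans (to (clone-class a-free x) cl) pa))
        where
        a = vertex p 0F 0F
        pa = pos-vertex p 0F 0F
        a-free : InNoTangle a
        a-free = untangled⇒free (¬t ∘ subst Tangled pa)

      block-part : ∀ p → IsPart (block p)
      block-part p with tangled? p
      ... | yes p-tangled = inj₂ (block-tangle p p-tangled)
      ... | no ¬t = inj₁ (block-clones p ¬t)

      part-block : ∀ {X} → IsPart X → ∃[ p ] X ≡ block p
      part-block (inj₁ (a , a-free , X≐)) = pos a , Subset.⊆-antisym
        (λ {x} x∈ → ∈-block⁺ (to (clone-class a-free x) (to (X≐ x) x∈)))
        (λ {x} x∈ → from (X≐ x) (from (clone-class a-free x) (∈-block⁻ x∈)))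
      part-block (inj₂ X-tangle) with tangle-block X-tangle
      ... | p , _ , eq = p , eq

      block-injective : ∀ {p q} → block p ≡ block q → p ≡ q
      block-injective {p} {q} eq = trans (sym (pos-vertex p 0F 0F)) (∈-block⁻
        (subst (vertex p 0F 0F ∈_) eq (∈-block⁺ (pos-vertex p 0F 0F))))

      blocks : List (Subset (length w * 4))
      blocks = List.tabulate block

      ∈-blocks⇒pos : ∀ i {a} → a ∈ lookup blocks i → toℕ (pos a) ≡ toℕ i
      ∈-blocks⇒pos i a∈ with lookup-tabulate-toℕ block i
      ... | p , p≡i , eq = trans (cong toℕ (∈-block⁻ (subst (_ ∈_) eq a∈))) p≡i

      listing : CompatibleListing
      listing = record
        { parts      = blocks
        ; unique     = Unique.tabulate⁺ block-injective
        ; exhaustive = λ X → mk⇔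
            (λ X∈ → let p , eq = ∈-tabulate⁻ X∈ in subst IsPart (sym eq) (block-part p))
            (λ X-part → let p , eq = part-block X-part in subst (_∈ₗ blocks) (sym eq) (∈-tabulate⁺ p))
        ; compatible = λ i j i≢j {a} {b} {p} {q} a∈ b∈ a∈p b∈q →
            compatible i j i≢j a b p q (∈-blocks⇒pos i a∈) (∈-blocks⇒pos j b∈)
              (to (L⇔lev p a) a∈p) (to (L⇔lev q b) b∈q)
        }
        where
        compatible : ∀ (i j : Fin (length blocks)) → i ≢ j → ∀ a b p q →
          toℕ (pos a) ≡ toℕ i → toℕ (pos b) ≡ toℕ j → lev a ≡ p → lev b ≡ q →
          a ⊏ b ⇔ (p + 2 ≤ q ⊎ (p + 1 ≡ q × i Fin.< j))
        compatible i j i≢j a b p q pa pb refl refl = mk⇔ (⇒ ∘ ⊏⇒≺)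
          [ (λ far → ≺⇒⊏ (inj₁ (subst (_≤ q) (+-comm p 2) far)))
          , (λ (eq , i<j) → ≺⇒⊏ (inj₂
              (trans (+-comm 1 p) eq , inj₁ (subst₂ _<_ (sym pa) (sym pb) i<j)))) ]′
          where
          ⇒ : a ≺ b → p + 2 ≤ q ⊎ (p + 1 ≡ q × i Fin.< j)
          ⇒ (inj₁ far) = inj₁ (subst (_≤ q) (+-comm 2 p) far)
          ⇒ (inj₂ (eq , inj₁ pa<pb)) = inj₂ (trans (+-comm p 1) eq , subst₂ _<_ pa pb pa<pb)
          -- An edge along a strand stays inside one block, hence under one index.
          ⇒ (inj₂ (_ , inj₂ (pa≡pb , _))) = contradiction
            (Fin.toℕ-injective (trans (sym pa) (trans (cong toℕ pa≡pb) pb))) i≢j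

      block-letter : ∀ p x → lookup w p ≡ x → HasLetter (block p) x
      block-letter p (c i) eq = clone-set (block-clones p ¬t) λ {a} a∈ →
          let pa = ∈-block⁻ a∈ in
          from (L⇔lev i a) (trans (untangled-lev {a} (¬t ∘ subst Tangled pa))
            (cong lo (trans (cong (lookup w) pa) eq)))
        where
        ¬t : ¬ Tangled p
        ¬t = <-irrefl refl ∘ subst (λ x → lo x < hi x) eq
      block-letter p (t i) eq =
        tangle (block-tangle p (subst (λ x → lo x < hi x) (sym eq) ≤-refl)) λ {a} a∈ →
          let la = trans (cong (lookup w) (∈-block⁻ a∈)) eq in
          Sum.map (from (L⇔lev i a)) (from (L⇔lev (suc i) a)) (levels a la)
        where
        levels : ∀ a → letter a ≡ t i → lev a ≡ i ⊎ lev a ≡ suc i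
        levels a la with up a
        ... | 0F = inj₁ (cong (λ x → height x 0F) la)
        ... | 1F = inj₂ (cong (λ x → height x 1F) la)

      word : IsWordOf listing w
      word = subst (Pointwise HasLetter blocks) (tabulate-lookup w)
        (Pointwise.tabulate⁺ λ p → block-letter p _ refl)

theorem3p11 : (m : Monoid.Carrier M) →
    (∃[ P ] ThreePlusOneFree P × m IsSkeletonOf P) ⇔
    ((∀ w → w Represents m → StartsWith-c₁-or-t₁₂ w) ×
    (∀ w → w Represents m → ¬ HasFactor-cᵢcᵢ w))
theorem3p11 m = mk⇔
  (λ (P , _ , X , w , wX , w≈m) →
    let open Skeletons P
        arrange = λ w′ w′≈m →
          arrangement-≈ (≈ᴹ-trans w≈m (≈ᴹ-sym w′≈m)) (listing⇒arrangement X wX)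
    in (λ w′ w′≈m x v w′≡ →
          low⇒starts x (starts-low {x} {v} (subst Arrangement w′≡ (arrange w′ w′≈m))))
     , (λ w′ w′≈m → no-factor (arrange w′ w′≈m)))
  (λ (starts , factor-free) →
    let open Realization m
        open Levels (λ x v m≈ → starts⇒low (starts (x ∷ v) (≈ᴹ-sym m≈) x v refl))
        open Listing factor-free
    in poset , threePlusOneFree , listing , m , word , ≈ᴹ-refl)
  where
  low⇒starts : ∀ x → lo x ≤ 1 → x ≡ c 1 ⊎ x ≡ t 1
  low⇒starts (c 1) _ = inj₁ refl
  low⇒starts (t 1) _ = inj₂ refl
  low⇒starts (c 0 ⦃ () ⦄) _
  low⇒starts (t 0 ⦃ () ⦄) _
  low⇒starts (c (suc (suc i))) (s≤s ())
  low⇒starts (t (suc (suc i))) (s≤s ())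
  starts⇒low : ∀ {x} → x ≡ c 1 ⊎ x ≡ t 1 → lo x ≤ 1
  starts⇒low (inj₁ refl) = ≤-refl
  starts⇒low (inj₂ refl) = ≤-refl
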